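{- For every prime power $q$, the class $\mathcal{M}_q$ of $GF(q)$-chordal matroids is closed under taking induced minors: if $M\in\mathcal{M}_q$ and $N$ is an induced minor of $M$, then $N\in\mathcal{M}_q$.
   Context: All matroids are simple; every contraction of a set from a matroid is immediately followed by simplification. For a prime power $q$, $P_r$ denotes the projective geometry $PG(r-1,q)$. If $M_1,M_2$ are matroids whose ground sets meet in a set $T$ that is a modular flat of $M_1$, with $M_1|T=M_2|T=N$, the generalized parallel connection $P_N(M_1,M_2)$ is the matroid on $E(M_1)\cup E(M_2)$ whose flats are the sets $X$ with $X\cap E(M_1)$ a flat of $M_1$ and $X\cap E(M_2)$ a flat of $M_2$ (when $T=\emptyset$ this is $M_1\oplus M_2$). $\mathcal{M}_q$ is the class of matroids that can be built from projective geometries over $GF(q)$ by a sequence of generalized parallel connections across projective geometries over $GF(q)$; its members are called $GF(q)$-chordal. An induced minor of a matroid $M$ is a matroid obtainable from $M$ by a sequence of restrictions to flats and contractions (each contraction followed by simplification). -}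

module Defs where

open import Level using (0ℓ)
open import Data.Nat using (ℕ; zero; suc; _+_; _∸_; _^_; _≤_; _<_)
open import Data.Nat.Primality using (Prime)
open import Data.Fin using (Fin; zero; suc)
open import Data.Fin.Subset using (Subset; _∈_; _∉_; _⊆_; _∪_; _∩_; _─_; ⁅_⁆; ∣_∣)
open import Data.Product using (Σ; ∃; ∃₂; _×_; _,_)
open import Relation.Binary.PropositionalEquality using (_≡_; _≢_)
open import Relation.Nullary using (¬_)
open import Algebra.Bundles using (CommutativeRing)

IsPrimePower : ℕ → Set
IsPrimePower q = ∃₂ λ p k → Prime p × q ≡ p ^ suc k

record FiniteField (q : ℕ) : Set₁ where
  field
    cring : CommutativeRing 0ℓ 0ℓ
  open CommutativeRing cring public
  field
    0≉1      : ¬ (0# ≈ 1#)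
    inverse  : ∀ x → ¬ (x ≈ 0#) → ∃ λ y → x * y ≈ 1#
    enum     : Fin q → Carrier
    enum-inj : ∀ i j → enum i ≈ enum j → i ≡ j
    enum-sur : ∀ x → ∃ λ i → enum i ≈ x

-- Matroids: a finite universe Fin n, a ground set E ⊆ Fin n, and a
-- rank function (only its values on subsets of E are meaningful).

record Matroid : Set where
  constructor mat
  field
    n : ℕ
    E : Subset n
    r : Subset n → ℕ
open Matroid public

record IsMatroid (M : Matroid) : Set where
  field
    r-bound  : ∀ X → X ⊆ E M → r M X ≤ ∣ X ∣
    r-mono   : ∀ X Y → X ⊆ Y → Y ⊆ E M → r M X ≤ r M Y
    r-submod : ∀ X Y → X ⊆ E M → Y ⊆ E M →
               r M (X ∪ Y) + r M (X ∩ Y) ≤ r M X + r M Y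

Flat : (M : Matroid) → Subset (n M) → Set
Flat M X = X ⊆ E M × (∀ e → e ∈ E M → e ∉ X → r M X < r M (X ∪ ⁅ e ⁆))

ModularFlat : (M : Matroid) → Subset (n M) → Set
ModularFlat M T = Flat M T ×
  (∀ F → Flat M F → r M (T ∪ F) + r M (T ∩ F) ≡ r M T + r M F)

Restrict : (M : Matroid) → Subset (n M) → Matroid
Restrict M F = mat (n M) F (r M)

Contract : (M : Matroid) → Subset (n M) → Matroid
Contract M C = mat (n M) (E M ─ C) (λ X → r M (X ∪ C) ∸ r M C)

-- S ⊆ E(M) is the ground set of a simplification of M: S consists of
-- non-loops, no two distinct elements of S are parallel, and every
-- non-loop of M is parallel to (or equal to) some element of S.
-- The simplification is then Restrict M S.
IsSimplification : (M : Matroid) → Subset (n M) → Set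
IsSimplification M S =
  S ⊆ E M ×
  (∀ e → e ∈ S → r M ⁅ e ⁆ ≡ 1) ×
  (∀ e f → e ∈ S → f ∈ S → e ≢ f → r M (⁅ e ⁆ ∪ ⁅ f ⁆) ≡ 2) ×
  (∀ e → e ∈ E M → r M ⁅ e ⁆ ≡ 1 → ∃ λ f → f ∈ S × r M (⁅ e ⁆ ∪ ⁅ f ⁆) ≡ 1)

-- Projective geometries PG(k-1, q) = P_k over a field F of order q:
-- the ground set is in bijection with the 1-dimensional subspaces of
-- F^k, and the rank of a set is the dimension of its span.

module _ {q : ℕ} (F : FiniteField q) where
  open FiniteField F using (Carrier; _≈_; 0#) renaming (_+_ to _+F_; _*_ to _*F_)

  sumF : ∀ {m} → (Fin m → Carrier) → Carrier
  sumF {zero}  f = 0#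
  sumF {suc m} f = f zero +F sumF (λ i → f (suc i))

  NonZeroVec : ∀ {k} → (Fin k → Carrier) → Set
  NonZeroVec w = ¬ (∀ i → w i ≈ 0#)

  Proportional : ∀ {k} → (Fin k → Carrier) → (Fin k → Carrier) → Set
  Proportional u w = ∃ λ c → ∀ i → u i ≈ c *F w i

  LinIndep : ∀ {m k} → (Fin m → Fin k → Carrier) → Subset m → Set
  LinIndep {m} {k} v Y =
    ∀ (c : Fin m → Carrier) → (∀ e → e ∉ Y → c e ≈ 0#) →
    (∀ i → sumF (λ e → c e *F v e i) ≈ 0#) → ∀ e → e ∈ Y → c e ≈ 0#

  record IsPG (k : ℕ) (M : Matroid) : Set where
    field
      vec      : Fin (n M) → Fin k → Carrier
      nonzero  : ∀ e → e ∈ E M → NonZeroVec (vec e)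
      distinct : ∀ e f → e ∈ E M → f ∈ E M →
                 Proportional (vec e) (vec f) → e ≡ f
      covers   : ∀ (w : Fin k → Carrier) → NonZeroVec w →
                 ∃ λ e → e ∈ E M × Proportional w (vec e)
      rank-ach : ∀ X → X ⊆ E M →
                 ∃ λ Y → Y ⊆ X × LinIndep vec Y × ∣ Y ∣ ≡ r M X
      rank-max : ∀ X → X ⊆ E M → ∀ Y → Y ⊆ X → LinIndep vec Y → ∣ Y ∣ ≤ r M X

IsPGq : ℕ → Matroid → Set₁
IsPGq q M = Σ (FiniteField q) λ F → ∃ λ k → IsPG F k M

-- GF(q)-chordal matroids.  A generalized parallel connection
-- P_N(M1, M2) restricts to M1 and M2 on E(M1), E(M2), so M is such a
-- connection iff E(M) = E1 ∪ E2 with M1 = M|E1, M2 = M|E2, T = E1 ∩ E2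
-- a modular flat of M1, M|T a projective geometry, and the flats of M
-- are exactly the X with X ∩ E1, X ∩ E2 flats of M1, M2.

data Chordal (q : ℕ) : Matroid → Set₁ where
  pg  : ∀ M → IsMatroid M → IsPGq q M → Chordal q M
  gpc : ∀ M (E₁ E₂ : Subset (n M)) →
        IsMatroid M →
        E M ≡ E₁ ∪ E₂ →
        Chordal q (Restrict M E₁) →
        Chordal q (Restrict M E₂) →
        ModularFlat (Restrict M E₁) (E₁ ∩ E₂) →
        IsPGq q (Restrict M (E₁ ∩ E₂)) →
        (∀ X → X ⊆ E M →
           (Flat M X → Flat (Restrict M E₁) (X ∩ E₁) × Flat (Restrict M E₂) (X ∩ E₂)) ×
           (Flat (Restrict M E₁) (X ∩ E₁) × Flat (Restrict M E₂) (X ∩ E₂) → Flat M X)) →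
        Chordal q M

data InducedMinor : Matroid → Matroid → Set where
  here  : ∀ M → InducedMinor M M
  restr : ∀ {N M} (F : Subset (n M)) → Flat M F →
          InducedMinor N (Restrict M F) → InducedMinor N M
  contr : ∀ {N M} (C S : Subset (n M)) → C ⊆ E M →
          IsSimplification (Contract M C) S →
          InducedMinor N (Restrict (Contract M C) S) → InducedMinor N M

{-# OPTIONS --safe #-}

-- The class is handled through closure operators: a flat T of E is modular iff t ∈ cl(X ∪ F) implies
-- t ∈ cl(X) for all flats F, all X with T ∩ F ⊆ X ⊆ T and all t ∈ T, a form in which modularity
-- composes and restricts without any counting of ranks.
--
-- The key fact is that every projective geometry T over GF(q) inside a chordal matroid is a modular
-- flat. In a projective geometry T is a flat since its lines already have q + 1 points, and flats
-- are modular. In a connection of E₁ and E₂ this makes E₁ and E₂ modular flats, and T, not being a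
-- union of two proper flats, lies in one of them.
--
-- Restricting a connection to a flat F gives the connection of F ∩ E₁ and F ∩ E₂. Contracting a flat
-- K and simplifying to S gives the connection of the parts of S spanned by E₁ ∪ K and by E₂ ∪ K: by
-- modularity each element of S spanned by Eᵢ ∪ K is parallel modulo K to an element of Eᵢ.
module Submission where

open import Defs
open import Level using (Level)
open import Data.Nat as Nat using (ℕ; zero; suc; _∸_; _≤_; _<_; z≤n; s≤s)
open import Data.Nat.Properties as ℕₚ using (module ≤-Reasoning)
open import Data.Nat.Tactic.RingSolver using (solve-∀)
open import Data.Bool using (true; false)
open import Data.Fin using (Fin; zero; suc; punchIn; punchOut)
open import Data.Fin.Properties using (_≟_; any?; all?; ¬∀⟶∃¬; punchIn-punchOut; suc-injective; pigeonhole; <⇒≢)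
open import Data.Fin.Subset
open import Data.Fin.Subset.Properties
open import Data.Vec using (_∷_; []; here; there; tabulate)
open import Data.Vec.Properties using ([]=⇒lookup; lookup⇒[]=; lookup∘tabulate)
open import Data.Vec.Functional using (insertAt)
open import Data.Vec.Functional.Properties using (insertAt-lookup; insertAt-punchIn)
open import Data.Product using (Σ; ∃; ∃₂; _×_; _,_; proj₁; proj₂)
open import Data.Sum using (_⊎_; inj₁; inj₂; [_,_]′)
open import Data.Empty using (⊥-elim)
open import Function using (_∘_; id)
open import Relation.Binary.PropositionalEquality
  using (_≡_; _≢_; refl; sym; trans; cong; cong₂; subst; subst₂; module ≡-Reasoning)
open import Relation.Nullary using (¬_; Dec; yes; no; does; ¬?; _×-dec_)
open import Relation.Nullary.Decidable using (dec-true; map′; decidable-stable)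
open import Relation.Unary using (Pred; Decidable)
import Algebra.Properties.Ring
import Algebra.Solver.Ring.NaturalCoefficients.Default
import Relation.Binary.Reasoning.Setoid

-- The definition of a connection is lopsided: `E₁ ∩ E₂` is assumed modular in `E₁` only.
-- Contraction needs both parts to be modular, because an element of `S` spanned by `Eᵢ ∪ K` may lie
-- outside `Eᵢ` and has to be traded for an element of `Eᵢ`. For `E₂` the missing modularity of
-- `E₁ ∩ E₂` is recovered from its being a projective geometry, and this is where the key fact
-- enters. A second obstacle is that the contracted set may straddle the parts, so that
-- independently chosen simplifications of contracted parts would not fit together. The induction
-- therefore fixes the ambient ground set `A`, the flat `K` and the transversal `S` once and for
-- all, and lets `E` run through the modular flats of `A` that occur in the construction of `A`;
-- each such `E` is assigned a subset of the same `S`.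

private variable
  ℓ : Level
  k l m q : ℕ
  X Y Z : Subset m
  x y : Fin m

-- Finite subsets

∪ˡ : x ∈ X → x ∈ X ∪ Y
∪ˡ {Y = Y} = p⊆p∪q Y

∪ʳ : x ∈ Y → x ∈ X ∪ Y
∪ʳ {X = X} = q⊆p∪q X _

∪-case : x ∈ X ∪ Y → x ∈ X ⊎ x ∈ Y
∪-case {X = X} {Y = Y} = x∈p∪q⁻ X Y

∪-lub : X ⊆ Z → Y ⊆ Z → X ∪ Y ⊆ Z
∪-lub f g = [ f , g ]′ ∘ ∪-case

∩⁺ : x ∈ X → x ∈ Y → x ∈ X ∩ Y
∩⁺ p q = x∈p∩q⁺ (p , q)

∩ˡ : x ∈ X ∩ Y → x ∈ X
∩ˡ {X = X} {Y = Y} = p∩q⊆p X Y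

∩ʳ : x ∈ X ∩ Y → x ∈ Y
∩ʳ {X = X} {Y = Y} = p∩q⊆q X Y

⁅⁆⊆ : x ∈ X → ⁅ x ⁆ ⊆ X
⁅⁆⊆ {X = X} x∈X y∈ = subst (_∈ X) (sym (x∈⁅y⁆⇒x≡y _ y∈)) x∈X

X⊆Y⇒X∩Y≡X : X ⊆ Y → X ∩ Y ≡ X
X⊆Y⇒X∩Y≡X X⊆Y = ⊆-antisym ∩ˡ λ x∈X → ∩⁺ x∈X (X⊆Y x∈X)

comprehension : {P : Pred (Fin m) ℓ} → Decidable P → Subset m
comprehension P? = tabulate (does ∘ P?)

module _ {P : Pred (Fin m) ℓ} (P? : Decidable P) where

  comprehension⁺ : P x → x ∈ comprehension P?
  comprehension⁺ {x = x} p =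
    lookup⇒[]= x _ (trans (lookup∘tabulate (does ∘ P?) x) (dec-true (P? x) p))

  comprehension⁻ : x ∈ comprehension P? → P x
  comprehension⁻ {x = x} x∈ with P? x | trans (sym (lookup∘tabulate (does ∘ P?) x)) ([]=⇒lookup x∈)
  ... | yes p | _ = p
  ... | no _  | ()

∣X∪x∣≡1+∣X∣ : x ∉ X → ∣ X ∪ ⁅ x ⁆ ∣ ≡ suc ∣ X ∣
∣X∪x∣≡1+∣X∣ {x = zero} {X = true ∷ X} x∉X = ⊥-elim (x∉X here)
∣X∪x∣≡1+∣X∣ {x = zero} {X = false ∷ X} x∉X = cong (suc ∘ ∣_∣) (∪-identityʳ X)
∣X∪x∣≡1+∣X∣ {x = suc x} {X = true ∷ X} x∉X = cong suc (∣X∪x∣≡1+∣X∣ (x∉X ∘ there))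
∣X∪x∣≡1+∣X∣ {x = suc x} {X = false ∷ X} x∉X = ∣X∪x∣≡1+∣X∣ (x∉X ∘ there)

⊆∧∣∣≡⇒⊇ : X ⊆ Y → ∣ X ∣ ≡ ∣ Y ∣ → Y ⊆ X
⊆∧∣∣≡⇒⊇ {X = X} X⊆Y eq {y} y∈Y with y ∈? X
... | yes y∈X = y∈X
... | no y∉X = ⊥-elim (ℕₚ.<-irrefl eq (p⊂q⇒∣p∣<∣q∣ (X⊆Y , y , y∈Y , y∉X)))

subset-induction : (P : Pred (Subset m) ℓ) → P ⊥ →
  (∀ X x → P X → P (X ∪ ⁅ x ⁆)) → ∀ X → P X
subset-induction P P⊥ step [] = P⊥
subset-induction P P⊥ step (b ∷ X)
  with subset-induction (P ∘ (false ∷_)) P⊥ (λ Y y → step (false ∷ Y) (suc y)) X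
subset-induction P P⊥ step (false ∷ X) | p = p
subset-induction P P⊥ step (true ∷ X) | p =
  subst (P ∘ (true ∷_)) (∪-identityʳ X) (step (false ∷ X) zero p)

-- Closure operators with the exchange property

record Closure (n : ℕ) : Set₁ where
  field
    Cl       : Subset n → Fin n → Set
    cl?      : ∀ X x → Dec (Cl X x)
    cl-ext   : x ∈ X → Cl X x
    cl-cut   : (∀ {x} → x ∈ X → Cl Y x) → Cl X y → Cl Y y
    exchange : Cl (X ∪ ⁅ x ⁆) y → ¬ Cl X y → Cl (X ∪ ⁅ y ⁆) x

  cl-mono : X ⊆ Y → Cl X y → Cl Y y
  cl-mono X⊆Y = cl-cut (cl-ext ∘ X⊆Y)

  cl-cut∪ : (∀ {x} → x ∈ X → Cl Z x) → (∀ {x} → x ∈ Y → Cl Z x) → Cl (X ∪ Y) y → Cl Z y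
  cl-cut∪ f g = cl-cut ([ f , g ]′ ∘ ∪-case)

  cl-⁅⁆ : Cl X x → ∀ {y} → y ∈ ⁅ x ⁆ → Cl X y
  cl-⁅⁆ {X = X} c y∈ = subst (Cl X) (sym (x∈⁅y⁆⇒x≡y _ y∈)) c

  FlatIn : Subset n → Subset n → Set
  FlatIn E X = X ⊆ E × (∀ {e} → e ∈ E → Cl X e → e ∈ X)

  -- A rank-free form of modularity of a flat T of E.
  ModularIn : Subset n → Subset n → Set
  ModularIn E T = FlatIn E T ×
    (∀ F → FlatIn E F → ∀ X → X ⊆ T → T ∩ F ⊆ X → ∀ {t} → t ∈ T → Cl (X ∪ F) t → Cl X t)

  clIn : Subset n → Subset n → Subset n
  clIn E X = comprehension (λ e → e ∈? E ×-dec cl? X e)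

  clIn⁺ : ∀ {E e} → e ∈ E → Cl X e → e ∈ clIn E X
  clIn⁺ {X = X} {E} e∈E c = comprehension⁺ (λ e → e ∈? E ×-dec cl? X e) (e∈E , c)

  clIn-⊆ : ∀ {E} → clIn E X ⊆ E
  clIn-⊆ {X = X} {E} = proj₁ ∘ comprehension⁻ (λ e → e ∈? E ×-dec cl? X e)

  clIn⁻ : ∀ {E e} → e ∈ clIn E X → Cl X e
  clIn⁻ {X = X} {E} = proj₂ ∘ comprehension⁻ (λ e → e ∈? E ×-dec cl? X e)

  clIn-flat : ∀ E X → FlatIn E (clIn E X)
  clIn-flat E X = clIn-⊆ , λ e∈E c → clIn⁺ e∈E (cl-cut clIn⁻ c)

  flat-∩ : ∀ {E D X} → FlatIn E X → D ⊆ E → FlatIn D (X ∩ D)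
  flat-∩ (_ , flat) D⊆E = ∩ʳ , λ e∈D c → ∩⁺ (flat (D⊆E e∈D) (cl-mono ∩ˡ c)) e∈D

  flat-trans : ∀ {E D X} → FlatIn E D → FlatIn D X → FlatIn E X
  flat-trans (D⊆E , flatD) (X⊆D , flatX) =
    D⊆E ∘ X⊆D , λ e∈E c → flatX (flatD e∈E (cl-mono X⊆D c)) c

  flat-⊆ : ∀ {E D X} → FlatIn E X → X ⊆ D → D ⊆ E → FlatIn D X
  flat-⊆ (_ , flat) X⊆D D⊆E = X⊆D , flat ∘ D⊆E

  -- Modularity of `E` replaces the flat `F` of `A` by its trace `F ∩ E`, which is a flat of `E`;
  -- modularity of `T` then removes the trace.
  modular-trans : ∀ {A E T} → ModularIn A E → ModularIn E T → ModularIn A T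
  modular-trans {A} {E} {T} (flatE , modE) (flatT , modT) = flat-trans flatE flatT , mod
    where
    mod : ∀ F → FlatIn A F → ∀ X → X ⊆ T → T ∩ F ⊆ X → ∀ {t} → t ∈ T → Cl (X ∪ F) t → Cl X t
    mod F flatF X X⊆T T∩F⊆X t∈T c =
      modT (F ∩ E) (flat-∩ flatF (proj₁ flatE)) X X⊆T
        (λ p → T∩F⊆X (∩⁺ (∩ˡ p) (∩ˡ (∩ʳ p)))) t∈T
        (modE F flatF (X ∪ (F ∩ E)) (∪-lub (proj₁ flatT ∘ X⊆T) ∩ʳ)
          (λ p → ∪ʳ (∩⁺ (∩ʳ p) (∩ˡ p))) (proj₁ flatT t∈T)
          (cl-mono (∪-lub (∪ˡ ∘ ∪ˡ) ∪ʳ) c))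

  modular-∩flat : ∀ {E T F} → ModularIn E T → FlatIn E F → ModularIn F (F ∩ T)
  modular-∩flat {E} {T} {F} (flatT , modT) flatF =
    subst (FlatIn F) (∩-comm T F) (flat-∩ flatT (proj₁ flatF)) ,
    λ G flatG X X⊆ ⊆X t∈ → modT G (flat-trans flatF flatG) X (∩ʳ ∘ X⊆)
      (λ p → ⊆X (∩⁺ (∩⁺ (proj₁ flatG (∩ʳ p)) (∩ˡ p)) (∩ʳ p))) (∩ʳ t∈)

  -- Suppose no such `e` exists. Then the flat `F` spanned by `f` and `K` meets `E` only inside `K`.
  -- Add the elements of `E` to `K` one at a time: if `x` were the one that makes `f` spanned,
  -- exchange would put `x` in the closure of `X ∪ F`, and modularity of `E` against `F` would put
  -- it in the closure of `X ∪ (K ∩ E)`, so `x` was redundant. Hence `f` is never spanned, against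
  -- the assumption.
  pull-back : ∀ {A E K f} → ModularIn A E → FlatIn A K → f ∈ A →
    Cl (E ∪ K) f → f ∉ K → ∃ λ e → e ∈ E × e ∉ K × Cl (⁅ f ⁆ ∪ K) e
  pull-back {A} {E} {K} {f} ((E⊆A , flatE) , modE) (K⊆A , flatK) f∈A cf f∉K
    with any? (λ e → e ∈? E ×-dec ¬? (e ∈? K) ×-dec cl? (⁅ f ⁆ ∪ K) e)
  ... | yes (e , p) = e , p
  ... | no none = ⊥-elim (avoid E id (cl-mono (∪-lub ∪ʳ ∪ˡ) cf))
    where
    F : Subset n
    F = clIn A (⁅ f ⁆ ∪ K)
    E∩F⊆K : E ∩ F ⊆ K
    E∩F⊆K {e} p with e ∈? K
    ... | yes e∈K = e∈K
    ... | no e∉K = ⊥-elim (none (e , ∩ˡ p , e∉K , clIn⁻ (∩ʳ p)))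
    avoid : ∀ X → X ⊆ E → ¬ Cl (K ∪ X) f
    avoid = subset-induction (λ X → X ⊆ E → ¬ Cl (K ∪ X) f)
      (λ _ c → f∉K (flatK f∈A (cl-mono (∪-lub id (⊥-elim ∘ ∉⊥)) c)))
      λ X x ih X∪x⊆E c → let X⊆E : X ⊆ E
                             X⊆E = X∪x⊆E ∘ ∪ˡ
                             c′ = cl-mono (∪-lub (∪ˡ ∘ ∪ˡ) (∪-lub (∪ˡ ∘ ∪ʳ) ∪ʳ)) c in
        ih X⊆E (cl-cut∪ cl-ext
          (cl-⁅⁆ (cl-mono (∪-lub ∪ʳ (∪ˡ ∘ ∩ˡ))
            (modE F (clIn-flat A _) (X ∪ (K ∩ E)) (∪-lub X⊆E ∩ʳ)
              (λ p → ∪ʳ (∩⁺ (E∩F⊆K p) (∩ˡ p))) (X∪x⊆E (∪ʳ (x∈⁅x⁆ x)))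
              (cl-mono
                (∪-lub (∪-lub (λ p → ∪ʳ (clIn⁺ (K⊆A p) (cl-ext (∪ʳ p)))) (∪ˡ ∘ ∪ˡ))
                  (⁅⁆⊆ (∪ʳ (clIn⁺ f∈A (cl-ext (∪ˡ (x∈⁅x⁆ f)))))))
                (exchange c′ (ih X⊆E))))))
          c′)

-- Contraction without deletion: the universe is unchanged and the elements of `K` become loops.
-- Sets before and after contraction can thus be compared directly.
_/_ : Closure m → Subset m → Closure m
𝒞 / K = record
  { Cl = λ X → C.Cl (X ∪ K)
  ; cl? = λ X → C.cl? (X ∪ K)
  ; cl-ext = C.cl-ext ∘ ∪ˡ
  ; cl-cut = λ f → C.cl-cut∪ f (C.cl-ext ∘ ∪ʳ)
  ; exchange = λ c ¬c → C.cl-mono (∪-lub (∪-lub (∪ˡ ∘ ∪ˡ) ∪ʳ) (∪ˡ ∘ ∪ʳ))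
      (C.exchange (C.cl-mono (∪-lub (∪-lub (∪ˡ ∘ ∪ˡ) ∪ʳ) (∪ˡ ∘ ∪ʳ)) c) ¬c)
  }
  where module C = Closure 𝒞

-- Rank functions

record IsRank (ρ : Subset m → ℕ) : Set where
  open Nat using (_+_)
  field
    bound  : ∀ X → ρ X ≤ ∣ X ∣
    mono   : X ⊆ Y → ρ X ≤ ρ Y
    submod : ∀ X Y → ρ (X ∪ Y) + ρ (X ∩ Y) ≤ ρ X + ρ Y

  ρ⊥≡0 : ρ ⊥ ≡ 0
  ρ⊥≡0 = ℕₚ.n≤0⇒n≡0 (subst (ρ ⊥ ≤_) (∣⊥∣≡0 m) (bound ⊥))

  submod-≤ : ∀ {V W} → V ⊆ X ∪ Y → W ⊆ X → W ⊆ Y → ρ V + ρ W ≤ ρ X + ρ Y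
  submod-≤ V⊆ W⊆X W⊆Y = ℕₚ.≤-trans
    (ℕₚ.+-mono-≤ (mono V⊆) (mono λ p → ∩⁺ (W⊆X p) (W⊆Y p))) (submod _ _)

  ρ-∪x≤ : ρ (X ∪ ⁅ x ⁆) ≤ suc (ρ X)
  ρ-∪x≤ {X = X} {x} = begin
    ρ (X ∪ ⁅ x ⁆)              ≤⟨ ℕₚ.m≤m+n _ _ ⟩
    ρ (X ∪ ⁅ x ⁆) + ρ (X ∩ ⁅ x ⁆) ≤⟨ submod X ⁅ x ⁆ ⟩
    ρ X + ρ ⁅ x ⁆              ≤⟨ ℕₚ.+-monoʳ-≤ (ρ X) (subst (ρ ⁅ x ⁆ ≤_) (∣⁅x⁆∣≡1 x) (bound ⁅ x ⁆)) ⟩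
    ρ X + 1                    ≡⟨ ℕₚ.+-comm (ρ X) 1 ⟩
    suc (ρ X)                  ∎
    where open ≤-Reasoning

  ρ-∪x-jump : ρ (X ∪ ⁅ x ⁆) ≢ ρ X → ρ (X ∪ ⁅ x ⁆) ≡ suc (ρ X)
  ρ-∪x-jump ≢ = ℕₚ.≤-antisym ρ-∪x≤ (ℕₚ.≤∧≢⇒< (mono ∪ˡ) (≢ ∘ sym))

  closed-mono : X ⊆ Y → ρ (X ∪ ⁅ x ⁆) ≡ ρ X → ρ (Y ∪ ⁅ x ⁆) ≡ ρ Y
  closed-mono {X = X} {Y = Y} {x} X⊆Y eq = ℕₚ.≤-antisym
    (ℕₚ.+-cancelʳ-≤ (ρ X) _ _ (begin
      ρ (Y ∪ ⁅ x ⁆) + ρ X ≤⟨ submod-≤ {X = X ∪ ⁅ x ⁆} {Y = Y} (∪-lub ∪ʳ (∪ˡ ∘ ∪ʳ)) ∪ˡ X⊆Y ⟩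
      ρ (X ∪ ⁅ x ⁆) + ρ Y ≡⟨ cong (_+ ρ Y) eq ⟩
      ρ X + ρ Y           ≡⟨ ℕₚ.+-comm (ρ X) (ρ Y) ⟩
      ρ Y + ρ X           ∎))
    (mono ∪ˡ)
    where open ≤-Reasoning

  absorb : ∀ Y → (∀ {y} → y ∈ Y → ρ (X ∪ ⁅ y ⁆) ≡ ρ X) → ρ (X ∪ Y) ≡ ρ X
  absorb {X = X} = subset-induction (λ Y → (∀ {y} → y ∈ Y → ρ (X ∪ ⁅ y ⁆) ≡ ρ X) → ρ (X ∪ Y) ≡ ρ X)
    (λ _ → cong ρ (∪-identityʳ X))
    λ Y y ih h → begin
      ρ (X ∪ Y ∪ ⁅ y ⁆)   ≡⟨ cong ρ (∪-assoc X Y ⁅ y ⁆) ⟨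
      ρ ((X ∪ Y) ∪ ⁅ y ⁆) ≡⟨ closed-mono ∪ˡ (h (∪ʳ (x∈⁅x⁆ y))) ⟩
      ρ (X ∪ Y)           ≡⟨ ih (h ∘ ∪ˡ) ⟩
      ρ X                 ∎
    where open ≡-Reasoning

  closure : Closure m
  closure = record
    { Cl = λ X x → ρ (X ∪ ⁅ x ⁆) ≡ ρ X
    ; cl? = λ X x → ρ (X ∪ ⁅ x ⁆) Nat.≟ ρ X
    ; cl-ext = λ x∈X → cong ρ (⊆-antisym (∪-lub id (⁅⁆⊆ x∈X)) ∪ˡ)
    ; cl-cut = cut
    ; exchange = exch
    }
    where
    cut : ∀ {X Y y} → (∀ {x} → x ∈ X → ρ (Y ∪ ⁅ x ⁆) ≡ ρ Y) →
      ρ (X ∪ ⁅ y ⁆) ≡ ρ X → ρ (Y ∪ ⁅ y ⁆) ≡ ρ Y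
    cut {X} {Y} {y} f eq = ℕₚ.≤-antisym (begin
      ρ (Y ∪ ⁅ y ⁆)       ≤⟨ mono (∪-lub (∪ˡ ∘ ∪ˡ) ∪ʳ) ⟩
      ρ ((Y ∪ X) ∪ ⁅ y ⁆) ≡⟨ closed-mono ∪ʳ eq ⟩
      ρ (Y ∪ X)           ≡⟨ absorb X f ⟩
      ρ Y                 ∎) (mono ∪ˡ)
      where open ≤-Reasoning
    exch : ∀ {X x y} → ρ ((X ∪ ⁅ x ⁆) ∪ ⁅ y ⁆) ≡ ρ (X ∪ ⁅ x ⁆) → ¬ ρ (X ∪ ⁅ y ⁆) ≡ ρ X →
      ρ ((X ∪ ⁅ y ⁆) ∪ ⁅ x ⁆) ≡ ρ (X ∪ ⁅ y ⁆)
    exch {X} {x} {y} eq ≢ = ℕₚ.≤-antisym (begin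
      ρ ((X ∪ ⁅ y ⁆) ∪ ⁅ x ⁆) ≤⟨ mono (∪-lub (∪-lub (∪ˡ ∘ ∪ˡ) ∪ʳ) (∪ˡ ∘ ∪ʳ)) ⟩
      ρ ((X ∪ ⁅ x ⁆) ∪ ⁅ y ⁆) ≡⟨ eq ⟩
      ρ (X ∪ ⁅ x ⁆)           ≤⟨ ρ-∪x≤ ⟩
      suc (ρ X)               ≡⟨ ρ-∪x-jump ≢ ⟨
      ρ (X ∪ ⁅ y ⁆)           ∎) (mono ∪ˡ)
      where open ≤-Reasoning

-- Closure and rank are tied by two implications instead of one being defined from the other. This
-- allows `𝒞 / K` to be paired with a rank function written in terms of any `C` that spans `K`.
record RankOf (𝒞 : Closure m) (ρ : Subset m → ℕ) : Set where
  open Nat using (_+_)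
  open Closure 𝒞
  field
    isRank : IsRank ρ
    cl⇒    : Cl X x → ρ (X ∪ ⁅ x ⁆) ≡ ρ X
    ⇒cl    : ρ (X ∪ ⁅ x ⁆) ≡ ρ X → Cl X x
  open IsRank isRank public

  ¬cl⇒ : ¬ Cl X x → ρ (X ∪ ⁅ x ⁆) ≡ suc (ρ X)
  ¬cl⇒ ¬c = ρ-∪x-jump (¬c ∘ ⇒cl)

  isMatroid : ∀ E → IsMatroid (mat m E ρ)
  isMatroid E = record
    { r-bound = λ X _ → bound X
    ; r-mono = λ _ _ X⊆Y _ → mono X⊆Y
    ; r-submod = λ X Y _ _ → submod X Y
    }

  Flat⇒FlatIn : ∀ {E X} → Flat (mat m E ρ) X → FlatIn E X
  Flat⇒FlatIn {E} {X} (X⊆E , flat) = X⊆E , closed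
    where
    closed : ∀ {e} → e ∈ E → Cl X e → e ∈ X
    closed {e} e∈E c with e ∈? X
    ... | yes e∈X = e∈X
    ... | no e∉X = ⊥-elim (ℕₚ.<-irrefl (sym (cl⇒ c)) (flat e e∈E e∉X))

  FlatIn⇒Flat : ∀ {E X} → FlatIn E X → Flat (mat m E ρ) X
  FlatIn⇒Flat (X⊆E , flat) = X⊆E , λ e e∈E e∉X →
    ℕₚ.≤∧≢⇒< (mono ∪ˡ) (λ eq → e∉X (flat e∈E (⇒cl (sym eq))))

  -- Add two submodular inequalities, one for `X` and `F`, whose intersection contains `T ∩ F`, and
  -- one for `T` and `X ∪ F ∪ ⁅ t ⁆`, whose intersection contains `X ∪ ⁅ t ⁆`. With the modular
  -- equality for `T` and `F` and with `t` spanned by `X ∪ F`, everything cancels except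
  -- `ρ (X ∪ ⁅ t ⁆) ≤ ρ X`.
  ModularFlat⇒ModularIn : ∀ {E T} → ModularFlat (mat m E ρ) T → ModularIn E T
  ModularFlat⇒ModularIn {E} {T} (flatT , mod) = Flat⇒FlatIn flatT ,
    λ F flatF X X⊆T T∩F⊆X {t} t∈T c →
      ⇒cl (ℕₚ.≤-antisym (ℕₚ.+-cancelˡ-≤ (ρ (X ∪ F) + (ρ T + ρ F)) _ _ (begin
        ρ (X ∪ F) + (ρ T + ρ F) + ρ (X ∪ ⁅ t ⁆)
          ≡⟨ cong (λ s → ρ (X ∪ F) + s + ρ (X ∪ ⁅ t ⁆)) (mod F (FlatIn⇒Flat flatF)) ⟨
        ρ (X ∪ F) + (ρ (T ∪ F) + ρ (T ∩ F)) + ρ (X ∪ ⁅ t ⁆)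
          ≡⟨ regroup (ρ (X ∪ F)) _ _ _ ⟩
        (ρ (X ∪ F) + ρ (T ∩ F)) + (ρ (T ∪ F) + ρ (X ∪ ⁅ t ⁆))
          ≤⟨ ℕₚ.+-mono-≤ (submod-≤ id T∩F⊆X ∩ʳ)
               (submod-≤ (∪-lub ∪ˡ (∪ʳ ∘ ∪ˡ ∘ ∪ʳ)) (∪-lub X⊆T (⁅⁆⊆ t∈T)) (∪-lub (∪ˡ ∘ ∪ˡ) ∪ʳ)) ⟩
        (ρ X + ρ F) + (ρ T + ρ ((X ∪ F) ∪ ⁅ t ⁆))
          ≡⟨ cong (λ s → ρ X + ρ F + (ρ T + s)) (cl⇒ c) ⟩
        (ρ X + ρ F) + (ρ T + ρ (X ∪ F))
          ≡⟨ regroup′ (ρ X) (ρ F) (ρ T) _ ⟩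
        ρ (X ∪ F) + (ρ T + ρ F) + ρ X ∎)) (mono ∪ˡ))
    where
    open ≤-Reasoning
    regroup : ∀ a b c d → a + (b + c) + d ≡ (a + c) + (b + d)
    regroup = solve-∀
    regroup′ : ∀ a b c d → (a + b) + (c + d) ≡ d + (c + b) + a
    regroup′ = solve-∀

  -- Build up `T` element by element over `T ∩ F` and over `F` in parallel. By modularity an element
  -- that raises the rank over `T ∩ F` also raises it over `F`, so the total increase over `F` is at
  -- least as large; the other inequality is submodularity.
  ModularIn⇒ModularFlat : ∀ {E T} → ModularIn E T → ModularFlat (mat m E ρ) T
  ModularIn⇒ModularFlat {E} {T} (flatT , mod) = FlatIn⇒Flat flatT , λ F flatF →
    ℕₚ.≤-antisym (submod T F) (begin
      ρ T + ρ F
        ≤⟨ ℕₚ.+-monoˡ-≤ (ρ F) (mono ∪ʳ) ⟩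
      ρ ((T ∩ F) ∪ T) + ρ F
        ≤⟨ chain F (Flat⇒FlatIn flatF) T id ⟩
      ρ (F ∪ T) + ρ (T ∩ F)
        ≡⟨ cong (λ V → ρ V + ρ (T ∩ F)) (∪-comm F T) ⟩
      ρ (T ∪ F) + ρ (T ∩ F) ∎)
    where
    open ≤-Reasoning
    chain : ∀ F → FlatIn E F → ∀ Z → Z ⊆ T → ρ ((T ∩ F) ∪ Z) + ρ F ≤ ρ (F ∪ Z) + ρ (T ∩ F)
    chain F flatF = subset-induction
      (λ Z → Z ⊆ T → ρ ((T ∩ F) ∪ Z) + ρ F ≤ ρ (F ∪ Z) + ρ (T ∩ F))
      (λ _ → subst₂ (λ V W → ρ V + ρ F ≤ ρ W + ρ (T ∩ F))
        (sym (∪-identityʳ (T ∩ F))) (sym (∪-identityʳ F)) (ℕₚ.≤-reflexive (ℕₚ.+-comm (ρ (T ∩ F)) (ρ F))))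
      step
      where
      step : ∀ Z z → (Z ⊆ T → ρ ((T ∩ F) ∪ Z) + ρ F ≤ ρ (F ∪ Z) + ρ (T ∩ F)) →
        Z ∪ ⁅ z ⁆ ⊆ T → ρ ((T ∩ F) ∪ Z ∪ ⁅ z ⁆) + ρ F ≤ ρ (F ∪ Z ∪ ⁅ z ⁆) + ρ (T ∩ F)
      step Z z ih Z∪z⊆T with cl? ((T ∩ F) ∪ Z) z
      ... | yes c = begin
        ρ ((T ∩ F) ∪ Z ∪ ⁅ z ⁆) + ρ F   ≡⟨ cong (λ V → ρ V + ρ F) (∪-assoc (T ∩ F) Z ⁅ z ⁆) ⟨
        ρ (((T ∩ F) ∪ Z) ∪ ⁅ z ⁆) + ρ F ≡⟨ cong (_+ ρ F) (cl⇒ c) ⟩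
        ρ ((T ∩ F) ∪ Z) + ρ F           ≤⟨ ih (Z∪z⊆T ∘ ∪ˡ) ⟩
        ρ (F ∪ Z) + ρ (T ∩ F)           ≤⟨ ℕₚ.+-monoˡ-≤ (ρ (T ∩ F)) (mono (∪-lub ∪ˡ (∪ʳ ∘ ∪ˡ))) ⟩
        ρ (F ∪ Z ∪ ⁅ z ⁆) + ρ (T ∩ F)   ∎
      ... | no ¬c = begin
        ρ ((T ∩ F) ∪ Z ∪ ⁅ z ⁆) + ρ F   ≡⟨ cong (λ V → ρ V + ρ F) (∪-assoc (T ∩ F) Z ⁅ z ⁆) ⟨
        ρ (((T ∩ F) ∪ Z) ∪ ⁅ z ⁆) + ρ F ≤⟨ ℕₚ.+-monoˡ-≤ (ρ F) ρ-∪x≤ ⟩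
        suc (ρ ((T ∩ F) ∪ Z) + ρ F)     ≤⟨ s≤s (ih (Z∪z⊆T ∘ ∪ˡ)) ⟩
        suc (ρ (F ∪ Z)) + ρ (T ∩ F)     ≡⟨ cong (_+ ρ (T ∩ F)) (¬cl⇒ ¬c′) ⟨
        ρ ((F ∪ Z) ∪ ⁅ z ⁆) + ρ (T ∩ F) ≡⟨ cong (λ V → ρ V + ρ (T ∩ F)) (∪-assoc F Z ⁅ z ⁆) ⟩
        ρ (F ∪ Z ∪ ⁅ z ⁆) + ρ (T ∩ F)   ∎
        where
        ¬c′ : ¬ Cl (F ∪ Z) z
        ¬c′ c = ¬c (mod F flatF ((T ∩ F) ∪ Z) (∪-lub ∩ˡ (Z∪z⊆T ∘ ∪ˡ)) ∪ˡ (Z∪z⊆T (∪ʳ (x∈⁅x⁆ z)))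
          (cl-mono (∪-lub ∪ʳ (∪ˡ ∘ ∪ʳ)) c))

rankOf : {ρ : Subset m → ℕ} (isRank : IsRank ρ) → RankOf (IsRank.closure isRank) ρ
rankOf isRank = record { isRank = isRank ; cl⇒ = id ; ⇒cl = id }

-- Simplicity, bases and the rank function of a contraction

Simple : Closure m → Subset m → Set
Simple 𝒞 E = (∀ {e} → e ∈ E → ¬ Cl ⊥ e) × (∀ {e f} → e ∈ E → f ∈ E → Cl ⁅ f ⁆ e → e ≡ f)
  where open Closure 𝒞

module _ {ρ : Subset m → ℕ} {𝒞 : Closure m} (rk : RankOf 𝒞 ρ) where
  open Nat using (_+_)
  open RankOf rk
  open Closure 𝒞

  basis : ∀ X → ∃ λ Y → Y ⊆ X × ρ Y ≡ ∣ Y ∣ × ρ Y ≡ ρ X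
  basis = subset-induction (λ X → ∃ λ Y → Y ⊆ X × ρ Y ≡ ∣ Y ∣ × ρ Y ≡ ρ X)
    (⊥ , id , trans ρ⊥≡0 (sym (∣⊥∣≡0 m)) , refl) step
    where
    step : ∀ X x → (∃ λ Y → Y ⊆ X × ρ Y ≡ ∣ Y ∣ × ρ Y ≡ ρ X) →
      ∃ λ Y → Y ⊆ X ∪ ⁅ x ⁆ × ρ Y ≡ ∣ Y ∣ × ρ Y ≡ ρ (X ∪ ⁅ x ⁆)
    step X x (Y , Y⊆X , ind , eq) with cl? X x
    ... | yes c = Y , ∪ˡ ∘ Y⊆X , ind , trans eq (sym (cl⇒ c))
    ... | no ¬c = Y ∪ ⁅ x ⁆ , ∪-lub (∪ˡ ∘ Y⊆X) ∪ʳ ,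
        trans jump (trans (cong suc ind) (sym (∣X∪x∣≡1+∣X∣ (¬c ∘ cl-ext ∘ Y⊆X)))) ,
        trans jump (trans (cong suc eq) (sym (¬cl⇒ ¬c)))
      where
      jump : ρ (Y ∪ ⁅ x ⁆) ≡ suc (ρ Y)
      jump = ¬cl⇒ (¬c ∘ cl-mono Y⊆X)

  -- Contracting `C` or anything between `C` and its closure gives the same closure operator. So an
  -- arbitrary contracted set may be replaced by a flat while its own rank function is kept.
  contraction-rank : ∀ {C K} → C ⊆ K → (∀ {x} → x ∈ K → Cl C x) →
    RankOf (𝒞 / K) (λ X → ρ (X ∪ C) ∸ ρ C)
  contraction-rank {C} {K} C⊆K K⊆clC = record
    { isRank = record
      { bound = λ X → ℕₚ.m≤n+o⇒m∸n≤o (ρ (X ∪ C)) (ρ C) (begin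
          ρ (X ∪ C)             ≤⟨ ℕₚ.m≤m+n _ _ ⟩
          ρ (X ∪ C) + ρ (X ∩ C) ≤⟨ submod X C ⟩
          ρ X + ρ C             ≤⟨ ℕₚ.+-monoˡ-≤ (ρ C) (bound X) ⟩
          ∣ X ∣ + ρ C           ≡⟨ ℕₚ.+-comm ∣ X ∣ (ρ C) ⟩
          ρ C + ∣ X ∣           ∎)
      ; mono = λ X⊆Y → ℕₚ.∸-monoˡ-≤ (ρ C) (mono (∪-lub (∪ˡ ∘ X⊆Y) ∪ʳ))
      ; submod = λ X Y → ℕₚ.+-cancelʳ-≤ (ρ C + ρ C) _ _ (begin
          (ρC (X ∪ Y) + ρC (X ∩ Y)) + (ρ C + ρ C) ≡⟨ interchange (ρC (X ∪ Y)) _ _ ⟩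
          (ρC (X ∪ Y) + ρ C) + (ρC (X ∩ Y) + ρ C) ≡⟨ cong₂ _+_ (ρC+ (X ∪ Y)) (ρC+ (X ∩ Y)) ⟩
          ρ ((X ∪ Y) ∪ C) + ρ ((X ∩ Y) ∪ C)       ≤⟨ submod-≤ (∪-lub (∪-lub (∪ˡ ∘ ∪ˡ) (∪ʳ ∘ ∪ˡ)) (∪ˡ ∘ ∪ʳ))
                                                       (∪-lub (∪ˡ ∘ ∩ˡ) ∪ʳ) (∪-lub (∪ˡ ∘ ∩ʳ) ∪ʳ) ⟩
          ρ (X ∪ C) + ρ (Y ∪ C)                   ≡⟨ cong₂ _+_ (ρC+ X) (ρC+ Y) ⟨
          (ρC X + ρ C) + (ρC Y + ρ C)             ≡⟨ interchange (ρC X) _ _ ⟨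
          (ρC X + ρC Y) + (ρ C + ρ C)             ∎)
      }
    ; cl⇒ = λ c → cong (_∸ ρ C) (trans (cong ρ (swap _ _))
        (cl⇒ (cl-cut∪ (cl-ext ∘ ∪ˡ) (cl-mono ∪ʳ ∘ K⊆clC) c)))
    ; ⇒cl = λ {X} {x} eq → cl-mono (∪-lub ∪ˡ (∪ʳ ∘ C⊆K)) (⇒cl (trans (cong ρ (sym (swap X x)))
        (trans (sym (ρC+ (X ∪ ⁅ x ⁆))) (trans (cong (_+ ρ C) eq) (ρC+ X)))))
    }
    where
    open ≤-Reasoning
    ρC : Subset m → ℕ
    ρC X = ρ (X ∪ C) ∸ ρ C
    ρC+ : ∀ X → ρC X + ρ C ≡ ρ (X ∪ C)
    ρC+ X = ℕₚ.m∸n+n≡m (mono ∪ʳ)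
    interchange : ∀ a b c → (a + b) + (c + c) ≡ (a + c) + (b + c)
    interchange = solve-∀
    swap : ∀ X x → (X ∪ ⁅ x ⁆) ∪ C ≡ (X ∪ C) ∪ ⁅ x ⁆
    swap X x = ⊆-antisym (∪-lub (∪-lub (∪ˡ ∘ ∪ˡ) ∪ʳ) (∪ˡ ∘ ∪ʳ))
                         (∪-lub (∪-lub (∪ˡ ∘ ∪ˡ) ∪ʳ) (∪ˡ ∘ ∪ʳ))

-- Linear algebra over a finite field

module LinearAlgebra {q : ℕ} (F : FiniteField q) where
  open FiniteField F hiding (_-_; zero) renaming (refl to ≈-refl; sym to ≈-sym; trans to ≈-trans)
  open Algebra.Properties.Ring ring using (-‿involutive; -0#≈0#; -‿distribˡ-*)
  open Relation.Binary.Reasoning.Setoid setoid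

  _≈?_ : (a b : Carrier) → Dec (a ≈ b)
  a ≈? b with enum-sur a | enum-sur b
  ... | i , i≈a | j , j≈b with i ≟ j
  ... | yes refl = yes (≈-trans (≈-sym i≈a) j≈b)
  ... | no i≢j = no λ a≈b → i≢j (enum-inj i j (≈-trans i≈a (≈-trans a≈b (≈-sym j≈b))))

  open Algebra.Solver.Ring.NaturalCoefficients.Default commutativeSemiring
    using (solve; _:=_; _:+_; _:*_)

  cancel-* : ∀ c x → c * x + (- c) * x ≈ 0#
  cancel-* c x = ≈-trans (≈-sym (distribʳ x c (- c))) (≈-trans (*-congʳ (-‿inverseʳ c)) (zeroˡ x))

  -- Differences are written with the factor `- c`, which the solver, being one for commutative
  -- semirings, can treat as an atom.
  add-subtract : ∀ c x w → w ≈ c * x + (w + (- c) * x)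
  add-subtract c x w = begin
    w                         ≈⟨ +-identityʳ w ⟨
    w + 0#                    ≈⟨ +-congˡ (cancel-* c x) ⟨
    w + (c * x + (- c) * x)   ≈⟨ solve 3 (λ w a b → w :+ (a :+ b) := a :+ (w :+ b)) ≈-refl w (c * x) ((- c) * x) ⟩
    c * x + (w + (- c) * x)   ∎

  V : ℕ → Set
  V k = Fin k → Carrier

  infix 4 _≋_
  _≋_ : V k → V k → Set
  v ≋ w = ∀ i → v i ≈ w i

  ≋0? : (w : V k) → Dec (∀ i → w i ≈ 0#)
  ≋0? w = all? (λ i → w i ≈? 0#)

  nonzero-coordinate : (w : V k) → NonZeroVec F w → ∃ λ i → ¬ (w i ≈ 0#)
  nonzero-coordinate w w≢0 = ¬∀⟶∃¬ _ _ (λ i → w i ≈? 0#) w≢0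

  cancel-inverse : ∀ {a b x y} → a * b ≈ 1# → y ≈ a * x → x ≈ b * y
  cancel-inverse {a} {b} {x} {y} ab≈1 y≈ax = begin
    x           ≈⟨ *-identityˡ x ⟨
    1# * x      ≈⟨ *-congʳ ab≈1 ⟨
    (a * b) * x ≈⟨ solve 3 (λ a b x → (a :* b) :* x := b :* (a :* x)) ≈-refl a b x ⟩
    b * (a * x) ≈⟨ *-congˡ y≈ax ⟨
    b * y       ∎

  proportional-nonzero : ∀ {u w : V k} {c} → NonZeroVec F u → u ≋ (λ i → c * w i) → ¬ (c ≈ 0#)
  proportional-nonzero {w = w} u≢0 u≋cw c≈0 =
    u≢0 λ i → ≈-trans (u≋cw i) (≈-trans (*-congʳ c≈0) (zeroˡ (w i)))

  proportional-sym : {u w : V k} → NonZeroVec F u → Proportional F u w → Proportional F w u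
  proportional-sym {w = w} u≢0 (c , u≋cw) with inverse c (proportional-nonzero {w = w} u≢0 u≋cw)
  ... | d , cd≈1 = d , λ i → cancel-inverse cd≈1 (u≋cw i)

  data Span (v : Fin m → V k) (X : Subset m) (w : V k) : Set where
    nil : (∀ i → w i ≈ 0#) → Span v X w
    add : ∀ c {e w′} → e ∈ X → Span v X w′ → w ≋ (λ i → c * v e i + w′ i) → Span v X w

  module _ {v : Fin m → V k} {X : Subset m} where

    span-resp : ∀ {w w′} → w ≋ w′ → Span v X w → Span v X w′
    span-resp eq (nil z) = nil λ i → ≈-trans (≈-sym (eq i)) (z i)
    span-resp eq (add c e∈X s p) = add c e∈X s λ i → ≈-trans (≈-sym (eq i)) (p i)

    span-multiple : ∀ c {e w} → e ∈ X → w ≋ (λ i → c * v e i) → Span v X w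
    span-multiple c e∈X p = add c {w′ = λ _ → 0#} e∈X (nil λ _ → ≈-refl)
      λ i → ≈-trans (p i) (≈-sym (+-identityʳ _))

    span-gen : ∀ {e} → e ∈ X → Span v X (v e)
    span-gen e∈X = span-multiple 1# e∈X λ i → ≈-sym (*-identityˡ _)

    span-+ : ∀ {w w′} → Span v X w → Span v X w′ → Span v X (λ i → w i + w′ i)
    span-+ (nil z) t = span-resp (λ i → ≈-trans (≈-sym (+-identityˡ _)) (+-congʳ (≈-sym (z i)))) t
    span-+ (add c e∈X s p) t = add c e∈X (span-+ s t) λ i → ≈-trans (+-congʳ (p i)) (+-assoc _ _ _)

    span-· : ∀ c {w} → Span v X w → Span v X (λ i → c * w i)
    span-· c (nil z) = nil λ i → ≈-trans (*-congˡ (z i)) (zeroʳ c)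
    span-· c (add d e∈X s p) = add (c * d) e∈X (span-· c s) λ i → ≈-trans (*-congˡ (p i))
      (solve 4 (λ c d x y → c :* (d :* x :+ y) := (c :* d) :* x :+ c :* y) ≈-refl c d _ _)

    span-neg : ∀ {w} → Span v X w → Span v X (λ i → - w i)
    span-neg {w} s = span-resp (λ i → ≈-trans (≈-sym (-‿distribˡ-* 1# (w i))) (-‿cong (*-identityˡ (w i))))
      (span-· (- 1#) s)

    span-sum : ∀ {l} (g : Fin l → V k) → (∀ j → Span v X (g j)) →
      Span v X (λ i → sumF F (λ j → g j i))
    span-sum {zero} g s = nil λ _ → ≈-refl
    span-sum {suc l} g s = span-+ (s zero) (span-sum (g ∘ suc) (s ∘ suc))

  span-bind : {v : Fin m → V k} {v′ : Fin l → V k} {X : Subset m} {Y : Subset l} {w : V k} →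
    (∀ {x} → x ∈ X → Span v′ Y (v x)) → Span v X w → Span v′ Y w
  span-bind f (nil z) = nil z
  span-bind f (add c e∈X s p) = span-resp (λ i → ≈-sym (p i)) (span-+ (span-· c (f e∈X)) (span-bind f s))

  span-proportional : {v : Fin m → V k} {X : Subset m} {u w : V k} →
    Proportional F u w → Span v X w → Span v X u
  span-proportional {w = w} (c , eq) s = span-resp {w = λ i → c * w i} (λ i → ≈-sym (eq i)) (span-· c s)

  span-mono : {v : Fin m → V k} {X Y : Subset m} {w : V k} → X ⊆ Y → Span v X w → Span v Y w
  span-mono X⊆Y = span-bind (span-gen ∘ X⊆Y)

  span-split : {v : Fin m → V k} {X Y : Subset m} {w : V k} → Span v (X ∪ Y) w →
    ∃₂ λ a b → Span v X a × Span v Y b × w ≋ (λ i → a i + b i)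
  span-split (nil z) = (λ _ → 0#) , (λ _ → 0#) , nil (λ _ → ≈-refl) , nil (λ _ → ≈-refl) ,
    λ i → ≈-trans (z i) (≈-sym (+-identityˡ 0#))
  span-split {X = X} {Y} (add c e∈ s p) with span-split {X = X} {Y} s | ∪-case {X = X} {Y = Y} e∈
  ... | a , b , sa , sb , q | inj₁ e∈X = _ , b , add c e∈X sa (λ _ → ≈-refl) , sb ,
        λ i → ≈-trans (p i) (≈-trans (+-congˡ (q i)) (≈-sym (+-assoc _ _ _)))
  ... | a , b , sa , sb , q | inj₂ e∈Y = a , _ , sa , add c e∈Y sb (λ _ → ≈-refl) ,
        λ i → ≈-trans (p i) (≈-trans (+-congˡ (q i))
          (solve 3 (λ x y z → x :+ (y :+ z) := y :+ (x :+ z)) ≈-refl _ _ _))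

  span-⊥ : {v : Fin m → V k} {w : V k} → Span v ⊥ w → ∀ i → w i ≈ 0#
  span-⊥ (nil z) = z
  span-⊥ (add c e∈ _ _) = ⊥-elim (∉⊥ e∈)

  span-⁅⁆ : {v : Fin m → V k} {e : Fin m} {w : V k} → Span v ⁅ e ⁆ w → Proportional F w (v e)
  span-⁅⁆ (nil z) = 0# , λ i → ≈-trans (z i) (≈-sym (zeroˡ _))
  span-⁅⁆ (add c e∈ s p) with x∈⁅y⁆⇒x≡y _ e∈ | span-⁅⁆ s
  ... | refl | d , q = c + d , λ i → ≈-trans (p i) (≈-trans (+-congˡ (q i)) (≈-sym (distribʳ _ c d)))

  -- The field is finite, so all coefficients of the last generator can be tried, each leaving a
  -- question about the smaller set.
  span? : (v : Fin m → V k) (X : Subset m) (w : V k) → Dec (Span v X w)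
  span? {m} {k} v = subset-induction (λ X → ∀ w → Dec (Span v X w)) (λ w → map′ nil span-⊥ (≋0? w)) step
    where
    step : ∀ X e → (∀ w → Dec (Span v X w)) → ∀ w → Dec (Span v (X ∪ ⁅ e ⁆) w)
    step X e dec w = map′ to from (any? (λ j → dec (λ i → w i + (- enum j) * v e i)))
      where
      to : (∃ λ j → Span v X (λ i → w i + (- enum j) * v e i)) → Span v (X ∪ ⁅ e ⁆) w
      to (j , s) = add (enum j) (∪ʳ (x∈⁅x⁆ e)) (span-mono ∪ˡ s) λ i →
        add-subtract (enum j) (v e i) (w i)
      from : Span v (X ∪ ⁅ e ⁆) w → ∃ λ j → Span v X (λ i → w i + (- enum j) * v e i)
      from s with span-split s
      ... | a , b , sa , sb , w≋a+b with span-⁅⁆ sb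
      ... | c , b≋cv with enum-sur c
      ... | j , j≈c = j , span-resp (λ i → begin
        a i
          ≈⟨ add-subtract (enum j) (v e i) (a i) ⟩
        enum j * v e i + (a i + (- enum j) * v e i)
          ≈⟨ solve 3 (λ a x y → x :+ (a :+ y) := (a :+ x) :+ y) ≈-refl (a i) (enum j * v e i) _ ⟩
        (a i + enum j * v e i) + (- enum j) * v e i
          ≈⟨ +-congʳ (≈-trans (+-congˡ (≈-trans (*-congʳ j≈c) (≈-sym (b≋cv i)))) (≈-sym (w≋a+b i))) ⟩
        w i + (- enum j) * v e i ∎) sa

  span-cancelˡ : {v : Fin m → V k} {X : Subset m} {w a b : V k} → w ≋ (λ i → a i + b i) →
    Span v X w → Span v X a → Span v X b
  span-cancelˡ {w = w} {a} {b} eq sw sa = span-resp (λ i → begin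
    w i + - a i         ≈⟨ +-congʳ (≈-trans (eq i) (+-comm (a i) (b i))) ⟩
    (b i + a i) + - a i ≈⟨ +-assoc (b i) (a i) (- a i) ⟩
    b i + (a i + - a i) ≈⟨ +-congˡ (-‿inverseʳ (a i)) ⟩
    b i + 0#            ≈⟨ +-identityʳ (b i) ⟩
    b i                 ∎) (span-+ sw (span-neg sa))

  -- Linear combinations and linear independence

  sumF-cong : {f g : Fin l → Carrier} → (∀ j → f j ≈ g j) → sumF F f ≈ sumF F g
  sumF-cong {zero} eq = ≈-refl
  sumF-cong {suc l} eq = +-cong (eq zero) (sumF-cong (eq ∘ suc))

  sumF-+ : (f g : Fin l → Carrier) → sumF F (λ j → f j + g j) ≈ sumF F f + sumF F g
  sumF-+ {zero} f g = ≈-sym (+-identityˡ 0#)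
  sumF-+ {suc l} f g = ≈-trans (+-congˡ (sumF-+ (f ∘ suc) (g ∘ suc)))
    (solve 4 (λ a b c d → (a :+ b) :+ (c :+ d) := (a :+ c) :+ (b :+ d)) ≈-refl _ _ _ _)

  sumF-zero : (f : Fin l → Carrier) → (∀ j → f j ≈ 0#) → sumF F f ≈ 0#
  sumF-zero {zero} f z = ≈-refl
  sumF-zero {suc l} f z = ≈-trans (+-cong (z zero) (sumF-zero (f ∘ suc) (z ∘ suc))) (+-identityˡ 0#)

  sumF-single : (f : Fin l → Carrier) (e : Fin l) → (∀ j → j ≢ e → f j ≈ 0#) → sumF F f ≈ f e
  sumF-single f zero z = ≈-trans (+-congˡ (sumF-zero (f ∘ suc) (λ j → z (suc j) λ ()))) (+-identityʳ _)
  sumF-single f (suc e) z = ≈-trans (+-cong (z zero λ ()) (sumF-single (f ∘ suc) e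
    (λ j j≢e → z (suc j) (j≢e ∘ suc-injective)))) (+-identityˡ _)

  point : Fin m → Carrier → Fin m → Carrier
  point e a j with j ≟ e
  ... | yes _ = a
  ... | no _ = 0#

  point-≡ : (e : Fin m) (a : Carrier) → point e a e ≈ a
  point-≡ e a with e ≟ e
  ... | yes _ = ≈-refl
  ... | no e≢e = ⊥-elim (e≢e refl)

  point-≢ : (e : Fin m) (a : Carrier) {j : Fin m} → j ≢ e → point e a j ≈ 0#
  point-≢ e a {j} j≢e with j ≟ e
  ... | yes j≡e = ⊥-elim (j≢e j≡e)
  ... | no _ = ≈-refl

  combination : (v : Fin m → V k) → (Fin m → Carrier) → V k
  combination v c i = sumF F (λ e → c e * v e i)

  combination-point : (v : Fin m → V k) (c : Fin m → Carrier) (e : Fin m) (a : Carrier) →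
    combination v (λ j → c j + point e a j) ≋ (λ i → combination v c i + a * v e i)
  combination-point v c e a i = begin
    sumF F (λ j → (c j + point e a j) * v j i)
      ≈⟨ sumF-cong (λ j → distribʳ (v j i) (c j) (point e a j)) ⟩
    sumF F (λ j → c j * v j i + point e a j * v j i)
      ≈⟨ sumF-+ (λ j → c j * v j i) (λ j → point e a j * v j i) ⟩
    combination v c i + sumF F (λ j → point e a j * v j i)
      ≈⟨ +-congˡ (sumF-single _ e (λ j j≢e → ≈-trans (*-congʳ (point-≢ e a j≢e)) (zeroˡ _))) ⟩
    combination v c i + point e a e * v e i
      ≈⟨ +-congˡ (*-congʳ (point-≡ e a)) ⟩
    combination v c i + a * v e i ∎

  Supported : Subset m → (Fin m → Carrier) → Set
  Supported X c = ∀ e → e ∉ X → c e ≈ 0#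

  combination-span : (v : Fin m → V k) {X : Subset m} {c : Fin m → Carrier} →
    Supported X c → Span v X (combination v c)
  combination-span {m} v {X} {c} supp = span-sum (λ e i → c e * v e i) term
    where
    term : ∀ e → Span v X (λ i → c e * v e i)
    term e with e ∈? X
    ... | yes e∈X = span-multiple (c e) e∈X λ _ → ≈-refl
    ... | no e∉X = nil λ i → ≈-trans (*-congʳ (supp e e∉X)) (zeroˡ _)

  span-combination : {v : Fin m → V k} {X : Subset m} {w : V k} → Span v X w →
    ∃ λ c → Supported X c × combination v c ≋ w
  span-combination {v = v} (nil z) = (λ _ → 0#) , (λ _ _ → ≈-refl) , λ i →
    ≈-trans (sumF-zero _ (λ j → zeroˡ (v j i))) (≈-sym (z i))
  span-combination {v = v} {X} (add a {e} e∈X s p) with span-combination s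
  ... | c , supp , eq = (λ j → c j + point e a j) ,
    (λ j j∉X → ≈-trans (+-cong (supp j j∉X) (point-≢ e a {j} λ { refl → j∉X e∈X })) (+-identityˡ 0#)) ,
    λ i → ≈-trans (combination-point v c e a i)
      (≈-trans (+-comm _ _) (≈-trans (+-congˡ (eq i)) (≈-sym (p i))))

  module _ (v : Fin m → V k) where

    indep-⊆ : ∀ {X Y} → X ⊆ Y → LinIndep F v Y → LinIndep F v X
    indep-⊆ X⊆Y ind c supp eq e e∈X = ind c (λ e e∉Y → supp e (e∉Y ∘ X⊆Y)) eq e (X⊆Y e∈X)

    indep-∉span : ∀ {X e} → e ∉ X → LinIndep F v (X ∪ ⁅ e ⁆) → ¬ Span v X (v e)
    indep-∉span {X} {e} e∉X ind s with span-combination s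
    ... | c , supp , eq = 0≉1 (begin
      0#               ≈⟨ -0#≈0# ⟨
      - 0#             ≈⟨ -‿cong (ind c′ supp′ zero′ e (∪ʳ (x∈⁅x⁆ e))) ⟨
      - c′ e           ≈⟨ -‿cong (≈-trans (+-cong (supp e e∉X) (point-≡ e (- 1#))) (+-identityˡ _)) ⟩
      - (- 1#)         ≈⟨ -‿involutive 1# ⟩
      1#               ∎)
      where
      c′ : Fin m → Carrier
      c′ j = c j + point e (- 1#) j
      supp′ : Supported (X ∪ ⁅ e ⁆) c′
      supp′ j j∉ = ≈-trans (+-cong (supp j (j∉ ∘ ∪ˡ))
        (point-≢ e (- 1#) {j} λ { refl → j∉ (∪ʳ (x∈⁅x⁆ e)) })) (+-identityˡ 0#)
      zero′ : ∀ i → combination v c′ i ≈ 0#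
      zero′ i = ≈-trans (combination-point v c e (- 1#) i) (≈-trans (+-congʳ (eq i))
        (≈-trans (+-congˡ (≈-trans (≈-sym (-‿distribˡ-* 1# _)) (-‿cong (*-identityˡ _)))) (-‿inverseʳ _)))

    relation-span : ∀ {X e} c → Supported (X ∪ ⁅ e ⁆) c → (∀ i → combination v c i ≈ 0#) →
      ¬ (c e ≈ 0#) → Span v X (v e)
    relation-span {X} {e} c supp eq ce≉0 with inverse (c e) ce≉0
    ... | d , cd≈1 = span-resp (λ i → ≈-sym (cancel-inverse cd≈1 (y≈ i)))
        (span-· d (span-neg (combination-span v supp′)))
      where
      c′ : Fin m → Carrier
      -- Deleting the coefficient of `e` from the relation leaves a combination supported on `X` and
      -- equal to the negative of `c e * v e`.
      c′ j = c j + point e (- c e) j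
      supp′ : Supported X c′
      supp′ j j∉X with j ≟ e
      ... | yes refl = -‿inverseʳ (c e)
      ... | no j≢e = ≈-trans (+-identityʳ _)
        (supp j ([ j∉X , j≢e ∘ x∈⁅y⁆⇒x≡y e ]′ ∘ ∪-case))
      y≈ : ∀ i → - combination v c′ i ≈ c e * v e i
      y≈ i = begin
        - combination v c′ i
          ≈⟨ -‿cong (≈-trans (combination-point v c e (- c e) i) (+-congʳ (eq i))) ⟩
        - (0# + (- c e) * v e i)
          ≈⟨ -‿cong (+-identityˡ _) ⟩
        - ((- c e) * v e i)
          ≈⟨ ≈-trans (-‿cong (≈-sym (-‿distribˡ-* (c e) (v e i)))) (-‿involutive _) ⟩
        c e * v e i ∎

    indep-∪ : ∀ {X e} → LinIndep F v X → ¬ Span v X (v e) → LinIndep F v (X ∪ ⁅ e ⁆)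
    indep-∪ {X} {e} ind ∉span c supp eq = λ f f∈ → [ ind c supp′ eq f , (λ f∈e → at-e f (x∈⁅y⁆⇒x≡y e f∈e)) ]′ (∪-case f∈)
      where
      ce≈0 : c e ≈ 0#
      ce≈0 with c e ≈? 0#
      ... | yes p = p
      ... | no ce≉0 = ⊥-elim (∉span (relation-span c supp eq ce≉0))
      at-e : ∀ f → f ≡ e → c f ≈ 0#
      at-e f refl = ce≈0
      supp′ : Supported X c
      supp′ j j∉X with j ≟ e
      ... | yes refl = ce≈0
      ... | no j≢e = supp j ([ j∉X , j≢e ∘ x∈⁅y⁆⇒x≡y e ]′ ∘ ∪-case)

    indep-from-span : ∀ {X} → (∀ {x} → x ∈ X → ¬ Span v (X ─ ⁅ x ⁆) (v x)) → LinIndep F v X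
    indep-from-span {X} ∉span c supp eq e e∈X with c e ≈? 0#
    ... | yes p = p
    ... | no ce≉0 = ⊥-elim (∉span e∈X (relation-span c (λ j j∉ → supp j (j∉ ∘ cover j)) eq ce≉0))
      where
      cover : ∀ j → j ∈ X → j ∈ (X ─ ⁅ e ⁆) ∪ ⁅ e ⁆
      cover j j∈X with j ≟ e
      ... | yes refl = ∪ʳ (x∈⁅x⁆ e)
      ... | no j≢e = ∪ˡ (x∈p∧x≢y⇒x∈p-y j∈X j≢e)

  -- The projection with kernel spanned by a. Taking b = −1/a p instead of 1/a p avoids subtraction.

  module Projection (a : V (suc k)) (p : Fin (suc k)) (b : Carrier) (ab≈-1 : a p * b ≈ - 1#) where

    proj : V (suc k) → V k
    proj w j = w (punchIn p j) + (w p * b) * a (punchIn p j)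

    proj-kernel : ∀ w → (∀ j → proj w j ≈ 0#) → Proportional F w a
    proj-kernel w z = - (w p * b) , coordinate
      where
      neg-neg : ∀ x → - ((- 1#) * x) ≈ x
      neg-neg x = ≈-trans (-‿cong (≈-trans (≈-sym (-‿distribˡ-* 1# x)) (-‿cong (*-identityˡ x)))) (-‿involutive x)
      coordinate : ∀ i → w i ≈ (- (w p * b)) * a i
      coordinate i with p ≟ i
      ... | yes refl = begin
        w p                   ≈⟨ neg-neg (w p) ⟨
        - ((- 1#) * w p)      ≈⟨ -‿cong (*-congʳ ab≈-1) ⟨
        - ((a p * b) * w p)   ≈⟨ -‿cong (solve 3 (λ w a b → (a :* b) :* w := (w :* b) :* a) ≈-refl (w p) (a p) b) ⟩
        - ((w p * b) * a p)   ≈⟨ -‿distribˡ-* _ _ ⟩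
        (- (w p * b)) * a p   ∎
      ... | no p≢i = subst (λ i → w i ≈ (- (w p * b)) * a i) (punchIn-punchOut p≢i) (begin
        w i′
          ≈⟨ add-subtract (w p * b) (a i′) (w i′) ⟩
        (w p * b) * a i′ + (w i′ + (- (w p * b)) * a i′)
          ≈⟨ solve 3 (λ x y z → x :+ (y :+ z) := (y :+ x) :+ z) ≈-refl ((w p * b) * a i′) (w i′) _ ⟩
        proj w (punchOut p≢i) + (- (w p * b)) * a i′
          ≈⟨ +-congʳ (z (punchOut p≢i)) ⟩
        0# + (- (w p * b)) * a i′
          ≈⟨ +-identityˡ _ ⟩
        (- (w p * b)) * a i′ ∎)
        where
        i′ : Fin (suc k)
        i′ = punchIn p (punchOut p≢i)

    proj-cong : ∀ {w w′} → w ≋ w′ → proj w ≋ proj w′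
    proj-cong eq j = +-cong (eq _) (*-congʳ (*-congʳ (eq p)))

    proj-linear : ∀ c w w′ → proj (λ i → c * w i + w′ i) ≋ (λ j → c * proj w j + proj w′ j)
    proj-linear c w w′ j = solve 7 (λ c x y wp wp′ b a →
      (c :* x :+ y) :+ ((c :* wp :+ wp′) :* b) :* a :=
      c :* (x :+ (wp :* b) :* a) :+ (y :+ (wp′ :* b) :* a))
      ≈-refl c _ _ (w p) (w′ p) b _

    proj-zero : proj (λ _ → 0#) ≋ (λ _ → 0#)
    proj-zero j = ≈-trans (+-identityˡ _) (≈-trans (*-congʳ (zeroˡ b)) (zeroˡ _))

    lift : V k → V (suc k)
    lift w = insertAt w p 0#

    proj-lift : ∀ w → proj (lift w) ≋ w
    proj-lift w j = begin
      lift w (punchIn p j) + (lift w p * b) * a (punchIn p j)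
        ≡⟨ cong₂ (λ x y → x + (y * b) * a (punchIn p j)) (insertAt-punchIn w p 0# j) (insertAt-lookup w p 0#) ⟩
      w j + (0# * b) * a (punchIn p j)
        ≈⟨ +-congˡ (≈-trans (*-congʳ (zeroˡ b)) (zeroˡ _)) ⟩
      w j + 0#
        ≈⟨ +-identityʳ _ ⟩
      w j ∎

    proj-a : proj a ≋ (λ _ → 0#)
    proj-a j = begin
      aⱼ + (a p * b) * aⱼ    ≈⟨ +-cong (≈-sym (*-identityˡ aⱼ)) (*-congʳ ab≈-1) ⟩
      1# * aⱼ + (- 1#) * aⱼ  ≈⟨ cancel-* 1# aⱼ ⟩
      0#                   ∎
      where
      aⱼ : Carrier
      aⱼ = a (punchIn p j)

    module _ {v : Fin m → V (suc k)} {X : Subset m} where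

      span-proj : ∀ {w} → Span v X w → Span (proj ∘ v) X (proj w)
      span-proj (nil z) = nil λ j → ≈-trans (proj-cong z j) (proj-zero j)
      span-proj (add c {e} {w′} e∈X s eq) =
        add c e∈X (span-proj s) λ j → ≈-trans (proj-cong eq j) (proj-linear c (v e) w′ j)

      -- Stated for an arbitrary preimage `w` of `u`, because each generator taken off in the
      -- projection is also subtracted from the preimage. The last remainder projects to zero, hence
      -- is a multiple of `a`, which `e` accounts for.
      span-unproj : ∀ {e} → v e ≋ a → ∀ {u} w → u ≋ proj w → Span (proj ∘ v) X u → Span v (X ∪ ⁅ e ⁆) w
      span-unproj {e} ve≋a w u≋ (nil z) with proj-kernel w (λ j → ≈-trans (≈-sym (u≋ j)) (z j))
      ... | c , w≋ca = span-multiple c (∪ʳ (x∈⁅x⁆ e)) λ i → ≈-trans (w≋ca i) (*-congˡ (≈-sym (ve≋a i)))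
      span-unproj {e} ve≋a {u} w u≋ (add c {x} {u′} x∈X s eq) =
        add c (∪ˡ x∈X) (span-unproj ve≋a w₀ u′≋ s) λ i →
          ≈-trans (add-subtract c (v x i) (w i)) (+-congˡ (+-comm _ _))
        where
        w₀ : V (suc k)
        w₀ i = (- c) * v x i + w i
        u′≋ : u′ ≋ proj w₀
        u′≋ j = begin
          u′ j
            ≈⟨ add-subtract c (proj (v x) j) (u′ j) ⟩
          c * proj (v x) j + (u′ j + (- c) * proj (v x) j)
            ≈⟨ solve 3 (λ x y z → x :+ (y :+ z) := z :+ (x :+ y)) ≈-refl (c * proj (v x) j) (u′ j) _ ⟩
          (- c) * proj (v x) j + (c * proj (v x) j + u′ j)
            ≈⟨ +-congˡ (≈-trans (≈-sym (eq j)) (u≋ j)) ⟩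
          (- c) * proj (v x) j + proj w j
            ≈⟨ proj-linear (- c) (v x) w j ⟨
          proj w₀ j ∎

-- Representations of projective geometries

module Representation {q : ℕ} (F : FiniteField q) where
  open FiniteField F hiding (_-_; zero) renaming (refl to ≈-refl; sym to ≈-sym; trans to ≈-trans)
  open LinearAlgebra F
  open Algebra.Properties.Ring ring using (-‿distribʳ-*)

  -- A projective geometry possibly with loops and parallel elements.
  record Rep (𝒞 : Closure m) (E : Subset m) : Set where
    constructor rep
    open Closure 𝒞
    field
      dim     : ℕ
      vec     : Fin m → V dim
      cl⇒span : ∀ {X e} → X ⊆ E → e ∈ E → Cl X e → Span vec X (vec e)
      span⇒cl : ∀ {X e} → X ⊆ E → e ∈ E → Span vec X (vec e) → Cl X e
      covers  : ∀ w → NonZeroVec F w → ∃ λ e → e ∈ E × Proportional F w (vec e)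

    span-flat : ∀ {X e} → FlatIn E X → e ∈ E → Span vec X (vec e) → e ∈ X
    span-flat (X⊆E , flat) e∈E s = flat e∈E (span⇒cl X⊆E e∈E s)

    nonloop : ∀ {e} → e ∈ E → ¬ Cl ⊥ e → NonZeroVec F (vec e)
    nonloop e∈E ¬c z = ¬c (span⇒cl (⊥-elim ∘ ∉⊥) e∈E (nil z))

    proportional⇒cl : ∀ {e f} → e ∈ E → f ∈ E → Proportional F (vec e) (vec f) → Cl ⁅ f ⁆ e
    proportional⇒cl e∈E f∈E (c , eq) = span⇒cl (⁅⁆⊆ f∈E) e∈E (span-multiple c (x∈⁅x⁆ _) eq)

    cl⇒proportional : ∀ {e f} → e ∈ E → f ∈ E → Cl ⁅ f ⁆ e → Proportional F (vec e) (vec f)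
    cl⇒proportional e∈E f∈E c = span-⁅⁆ (cl⇒span (⁅⁆⊆ f∈E) e∈E c)

    point-of-span : ∀ {X w} → Span vec X w → NonZeroVec F w →
      ∃ λ e → e ∈ E × Proportional F w (vec e) × Span vec X (vec e)
    point-of-span {w = w} s w≢0 = let e , e∈E , w∝e = covers w w≢0 in
      e , e∈E , w∝e , span-proportional (proportional-sym w≢0 w∝e) s

    -- Write `t` as `a + b` with `a` spanned by `X` and `b` by `P`. Then `b` is also spanned by `T`,
    -- being the difference of `t` and `a`. If `b` is nonzero, the point on it lies in both flats,
    -- thus in `T ∩ P` and so in `X`.
    flat⇒modular : ∀ {T} → FlatIn E T → ModularIn E T
    flat⇒modular {T} flatT@(T⊆E , _) = flatT , mod
      where
      mod : ∀ P → FlatIn E P → ∀ X → X ⊆ T → T ∩ P ⊆ X → ∀ {t} → t ∈ T → Cl (X ∪ P) t → Cl X t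
      mod P flatP@(P⊆E , _) X X⊆T T∩P⊆X {t} t∈T c
        with span-split (cl⇒span (∪-lub (T⊆E ∘ X⊆T) P⊆E) (T⊆E t∈T) c)
      ... | a , b , sa , sb , t≋a+b = span⇒cl (T⊆E ∘ X⊆T) (T⊆E t∈T)
          (span-resp (λ i → ≈-sym (t≋a+b i)) (span-+ sa b∈X))
        where
        b∈T : Span vec T b
        b∈T = span-cancelˡ t≋a+b (span-gen t∈T) (span-mono X⊆T sa)
        b∈X : Span vec X b
        b∈X with ≋0? b
        ... | yes z = nil z
        ... | no b≢0 = let g , g∈E , (d , b≋dg) , sg = point-of-span sb b≢0
                           g∈T = span-flat flatT g∈E
                             (span-proportional (proportional-sym b≢0 (d , b≋dg)) b∈T) in
            span-multiple d (T∩P⊆X (∩⁺ g∈T (span-flat flatP g∈E sg))) b≋dg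

    -- Given `a` outside `P` and `b` outside `Q`, one has `a ∈ Q` and `b ∈ P`, and the point on the
    -- sum of their vectors lies in neither flat: in `P` it would force `a` into `P`, in `Q` it
    -- would force `b` into `Q`.
    not-union-of-proper-flats : ∀ {P Q} → FlatIn E P → FlatIn E Q → E ⊆ P ∪ Q → E ⊆ P ⊎ E ⊆ Q
    not-union-of-proper-flats {P} {Q} flatP flatQ E⊆P∪Q
      with any? (λ a → a ∈? E ×-dec ¬? (a ∈? P)) | any? (λ b → b ∈? E ×-dec ¬? (b ∈? Q))
    ... | no none | _ = inj₁ stable
      where
      stable : ∀ {x} → x ∈ E → x ∈ P
      stable {x} x∈E with x ∈? P
      ... | yes x∈P = x∈P
      ... | no x∉P = ⊥-elim (none (x , x∈E , x∉P))
    ... | yes _ | no none = inj₂ stable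
      where
      stable : ∀ {x} → x ∈ E → x ∈ Q
      stable {x} x∈E with x ∈? Q
      ... | yes x∈Q = x∈Q
      ... | no x∉Q = ⊥-elim (none (x , x∈E , x∉Q))
    ... | yes (a , a∈E , a∉P) | yes (b , b∈E , b∉Q) = ⊥-elim ([ c∉P , c∉Q ]′ (∪-case (E⊆P∪Q c∈E)))
      where
      a∈Q : a ∈ Q
      a∈Q = [ (λ a∈P → ⊥-elim (a∉P a∈P)) , id ]′ (∪-case (E⊆P∪Q a∈E))
      b∈P : b ∈ P
      b∈P = [ id , (λ b∈Q → ⊥-elim (b∉Q b∈Q)) ]′ (∪-case (E⊆P∪Q b∈E))
      w : V dim
      w i = vec a i + vec b i
      subtract-b : ∀ {X} → Span vec X w → Span vec X (vec b) → Span vec X (vec a)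
      subtract-b = span-cancelˡ (λ i → +-comm (vec a i) (vec b i))
      subtract-a : ∀ {X} → Span vec X w → Span vec X (vec a) → Span vec X (vec b)
      subtract-a = span-cancelˡ (λ _ → ≈-refl)
      w≢0 : NonZeroVec F w
      w≢0 z = a∉P (span-flat flatP a∈E (subtract-b (nil z) (span-gen b∈P)))
      covered : ∃ λ e → e ∈ E × Proportional F w (vec e)
      covered = covers w w≢0
      c : Fin _
      c = proj₁ covered
      c∈E : c ∈ E
      c∈E = proj₁ (proj₂ covered)
      w∈ : ∀ {X} → c ∈ X → Span vec X w
      w∈ c∈X = span-multiple (proj₁ (proj₂ (proj₂ covered))) c∈X (proj₂ (proj₂ (proj₂ covered)))
      c∉P : c ∉ P
      c∉P c∈P = a∉P (span-flat flatP a∈E (subtract-b (w∈ c∈P) (span-gen b∈P)))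
      c∉Q : c ∉ Q
      c∉Q c∈Q = b∉Q (span-flat flatQ b∈E (subtract-a (w∈ c∈Q) (span-gen a∈Q)))

  -- Contractions, parallel copies and flats of represented geometries

  open Closure using (Cl)

  rep-cong : ∀ {𝒞 𝒟 : Closure m} {E} →
    (∀ {X e} → X ⊆ E → e ∈ E → Cl 𝒞 X e → Cl 𝒟 X e) →
    (∀ {X e} → X ⊆ E → e ∈ E → Cl 𝒟 X e → Cl 𝒞 X e) → Rep 𝒞 E → Rep 𝒟 E
  rep-cong to from (rep dim vec cl⇒span span⇒cl covers) = rep dim vec
    (λ X⊆E e∈E → cl⇒span X⊆E e∈E ∘ from X⊆E e∈E)
    (λ X⊆E e∈E → to X⊆E e∈E ∘ span⇒cl X⊆E e∈E) covers

  rep-contract₁ : ∀ {𝒞 : Closure m} {E e} → e ∈ E → Rep 𝒞 E → Rep (𝒞 / ⁅ e ⁆) E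
  rep-contract₁ {𝒞 = 𝒞} {E} {e} e∈E R@(rep dim vec cl⇒span span⇒cl covers) with Closure.cl? 𝒞 ⊥ e
  -- Contracting a loop changes nothing; otherwise the vector of `e` is nonzero and serves as the
  -- centre of a projection that lowers the dimension by one.
  ... | yes c = rep-cong {𝒞 = 𝒞} {𝒞 / ⁅ e ⁆} (λ _ _ → cl-mono ∪ˡ)
      (λ _ _ → cl-cut∪ cl-ext (cl-⁅⁆ (cl-mono (⊥-elim ∘ ∉⊥) c))) R
    where open Closure 𝒞 using (cl-mono; cl-cut∪; cl-ext; cl-⁅⁆)
  ... | no ¬c with nonzero-coordinate (vec e) (Rep.nonloop R e∈E ¬c)
  ... | p , ep≉0 with inverse (vec e p) ep≉0
  rep-contract₁ {𝒞 = 𝒞} {E} {e} e∈E (rep (suc k) vec cl⇒span span⇒cl covers)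
    | no ¬c | p , ep≉0 | b , ep*b≈1 = rep k (proj ∘ vec)
      (λ X⊆E x∈E c → span-bind (spanned _) (span-proj (cl⇒span (∪-lub X⊆E (⁅⁆⊆ e∈E)) x∈E c)))
      (λ X⊆E x∈E s → span⇒cl (∪-lub X⊆E (⁅⁆⊆ e∈E)) x∈E (span-unproj (λ _ → ≈-refl) _ (λ _ → ≈-refl) s))
      covers′
    where
    open Projection (vec e) p (- b) (≈-trans (≈-sym (-‿distribʳ-* _ b)) (-‿cong ep*b≈1))
    spanned : ∀ X {x} → x ∈ X ∪ ⁅ e ⁆ → Span (proj ∘ vec) X (proj (vec x))
    spanned X {x} x∈ with ∪-case x∈
    ... | inj₁ x∈X = span-gen x∈X
    ... | inj₂ x∈e with x∈⁅y⁆⇒x≡y e x∈e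
    ... | refl = nil proj-a
    covers′ : ∀ w → NonZeroVec F w → ∃ λ x → x ∈ E × Proportional F w (proj (vec x))
    covers′ w w≢0 with covers (lift w) (λ z → w≢0 λ j → ≈-trans (≈-sym (proj-lift w j)) (≈-trans (proj-cong z j) (proj-zero j)))
    ... | x , x∈E , c , eq = x , x∈E , c , λ j → ≈-trans (≈-sym (proj-lift w j))
      (≈-trans (proj-cong (λ i → ≈-trans (eq i) (≈-sym (+-identityʳ _))) j)
        (≈-trans (proj-linear c (vec x) (λ _ → 0#) j) (≈-trans (+-congˡ (proj-zero j)) (+-identityʳ _))))

  rep-contract : ∀ {𝒞 : Closure m} {E} → Rep 𝒞 E → ∀ K → K ⊆ E → Rep (𝒞 / K) E
  rep-contract {𝒞 = 𝒞} {E} R = subset-induction (λ K → K ⊆ E → Rep (𝒞 / K) E)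
    (λ _ → rep-cong {𝒞 = 𝒞} {𝒞 / ⊥} (λ _ _ → cl-mono ∪ˡ) (λ _ _ → cl-mono (∪-lub id (⊥-elim ∘ ∉⊥))) R)
    λ K e ih K∪e⊆E → rep-cong {𝒞 = (𝒞 / K) / ⁅ e ⁆} {𝒞 / (K ∪ ⁅ e ⁆)}
      (λ _ _ → cl-mono (∪-lub (∪-lub ∪ˡ (∪ʳ ∘ ∪ʳ)) (∪ʳ ∘ ∪ˡ)))
      (λ _ _ → cl-mono (∪-lub (∪ˡ ∘ ∪ˡ) (∪-lub ∪ʳ (∪ˡ ∘ ∪ʳ))))
      (rep-contract₁ (K∪e⊆E (∪ʳ (x∈⁅x⁆ e))) (ih (K∪e⊆E ∘ ∪ˡ)))
    where open Closure 𝒞 using (cl-mono)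

  Parallel : Closure m → Fin m → Fin m → Set
  Parallel 𝒞 e f = Cl 𝒞 ⁅ e ⁆ f × Cl 𝒞 ⁅ f ⁆ e

  -- Parallel elements are interchangeable in closures, so each `w` can receive the vector of a
  -- parallel element of `U`. In the other direction only nonloops of `U` need a partner: `covers`
  -- concerns nonzero vectors, and loops carry the zero vector.
  rep-transfer : ∀ {𝒞 : Closure m} {U W : Subset m} →
    (∀ {w} → w ∈ W → ∃ λ u → u ∈ U × Parallel 𝒞 u w) →
    (∀ {u} → u ∈ U → ¬ Cl 𝒞 ⊥ u → ∃ λ w → w ∈ W × Parallel 𝒞 u w) →
    Rep 𝒞 U → Rep 𝒞 W
  rep-transfer {m = m} {𝒞 = 𝒞} {U} {W} to from R = rep R.dim (R.vec ∘ φ)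
    (λ X⊆W w∈W c → span-bind (image⇒ _) (R.cl⇒span (image⊆U X⊆W) (φ∈U w∈W) (cl-φ X⊆W w∈W c)))
    (λ X⊆W w∈W s → cl-φ⁻ X⊆W w∈W
      (R.span⇒cl (image⊆U X⊆W) (φ∈U w∈W) (span-bind (λ x∈X → span-gen (image⁺ x∈X)) s)))
    covers′
    where
    module R = Rep R
    open Closure 𝒞 using (cl-cut; cl-mono; cl-⁅⁆)
    φ : Fin m → Fin m
    φ x with x ∈? W
    ... | yes x∈W = proj₁ (to x∈W)
    -- An arbitrary value: `φ` is applied only to elements of `W`.
    ... | no _ = x
    φ-spec : ∀ {x} → x ∈ W → φ x ∈ U × Parallel 𝒞 (φ x) x
    φ-spec {x} x∈W with x ∈? W
    ... | yes x∈W = proj₂ (to x∈W)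
    ... | no x∉W = ⊥-elim (x∉W x∈W)
    φ∈U : ∀ {x} → x ∈ W → φ x ∈ U
    φ∈U = proj₁ ∘ φ-spec
    image? : (X : Subset m) → ∀ u → Dec (∃ λ x → x ∈ X × φ x ≡ u)
    image? X u = any? (λ x → x ∈? X ×-dec φ x ≟ u)
    image : Subset m → Subset m
    image X = comprehension (image? X)
    image⁺ : ∀ {X x} → x ∈ X → φ x ∈ image X
    image⁺ x∈X = comprehension⁺ (image? _) (_ , x∈X , refl)
    image⊆U : ∀ {X} → X ⊆ W → image X ⊆ U
    image⊆U X⊆W u∈ with comprehension⁻ (image? _) u∈
    ... | x , x∈X , refl = φ∈U (X⊆W x∈X)
    image⇒ : ∀ X {u} → u ∈ image X → Span (R.vec ∘ φ) X (R.vec u)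
    image⇒ X u∈ with comprehension⁻ (image? _) u∈
    ... | x , x∈X , refl = span-gen x∈X
    cl-φ : ∀ {X w} → X ⊆ W → w ∈ W → Cl 𝒞 X w → Cl 𝒞 (image X) (φ w)
    cl-φ X⊆W w∈W c = cl-cut (cl-⁅⁆ (cl-cut (λ x∈X → cl-mono (⁅⁆⊆ (image⁺ x∈X))
      (proj₁ (proj₂ (φ-spec (X⊆W x∈X))))) c)) (proj₂ (proj₂ (φ-spec w∈W)))
    cl-φ⁻ : ∀ {X w} → X ⊆ W → w ∈ W → Cl 𝒞 (image X) (φ w) → Cl 𝒞 X w
    cl-φ⁻ {X} X⊆W w∈W c = cl-cut (cl-⁅⁆ (cl-cut member c)) (proj₁ (proj₂ (φ-spec w∈W)))
      where
      member : ∀ {u} → u ∈ image X → Cl 𝒞 X u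
      member u∈ with comprehension⁻ (image? _) u∈
      ... | x , x∈X , refl = cl-mono (⁅⁆⊆ x∈X) (proj₂ (proj₂ (φ-spec (X⊆W x∈X))))
    covers′ : ∀ v → NonZeroVec F v → ∃ λ w → w ∈ W × Proportional F v (R.vec (φ w))
    covers′ v v≢0 =
      let u , u∈U , c , eq = R.covers v v≢0
          nonloop = λ loop → v≢0 λ i → ≈-trans (eq i)
            (≈-trans (*-congˡ (span-⊥ (R.cl⇒span (⊥-elim ∘ ∉⊥) u∈U loop) i)) (zeroʳ c))
          w , w∈W , _ , clwu = from u∈U nonloop
          d , eq′ = R.cl⇒proportional u∈U (φ∈U w∈W) (cl-cut (cl-⁅⁆ (proj₁ (proj₂ (φ-spec w∈W)))) clwu)
      in w , w∈W , c * d , λ i → ≈-trans (eq i) (≈-trans (*-congˡ (eq′ i)) (≈-sym (*-assoc c d (R.vec (φ w) i))))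

  -- A flat G of a projective geometry is identified with the contraction by a complement K of G.
  rep-flat : ∀ {𝒞 : Closure m} {E G} → Closure.FlatIn 𝒞 E G → Rep 𝒞 E → Rep 𝒞 G
  rep-flat {m = m} {𝒞} {E} {G} flatG@(G⊆E , _) R with complement E id
    where
    open Closure 𝒞 hiding (Cl)
    -- `K` grows greedily by elements that `G ∪ K` does not span yet. Such a `z` cannot spoil
    -- skewness: if it made some `g` of `G` newly spanned, exchange would place `z` in the closure
    -- of `G ∪ K`.
    complement : ∀ Z → Z ⊆ E → ∃ λ K → K ⊆ E × (∀ {z} → z ∈ Z → Cl 𝒞 (G ∪ K) z) ×
      (∀ {X g} → X ⊆ G → g ∈ G → Cl 𝒞 (X ∪ K) g → Cl 𝒞 X g)
    complement = subset-induction _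
      (λ _ → ⊥ , (⊥-elim ∘ ∉⊥) , (⊥-elim ∘ ∉⊥) , λ _ _ → cl-mono (∪-lub id (⊥-elim ∘ ∉⊥)))
      step
      where
      step : ∀ Z z →
        (Z ⊆ E → ∃ λ K → K ⊆ E × (∀ {z} → z ∈ Z → Cl 𝒞 (G ∪ K) z) ×
          (∀ {X g} → X ⊆ G → g ∈ G → Cl 𝒞 (X ∪ K) g → Cl 𝒞 X g)) →
        Z ∪ ⁅ z ⁆ ⊆ E → ∃ λ K → K ⊆ E × (∀ {x} → x ∈ Z ∪ ⁅ z ⁆ → Cl 𝒞 (G ∪ K) x) ×
          (∀ {X g} → X ⊆ G → g ∈ G → Cl 𝒞 (X ∪ K) g → Cl 𝒞 X g)
      step Z z ih Z∪z⊆E with ih (Z∪z⊆E ∘ ∪ˡ)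
      ... | K , K⊆E , spanning , skew with cl? (G ∪ K) z
      ... | yes c = K , K⊆E , [ spanning , cl-⁅⁆ c ]′ ∘ ∪-case , skew
      ... | no ¬c = K ∪ ⁅ z ⁆ , ∪-lub K⊆E (Z∪z⊆E ∘ ∪ʳ) ,
          [ cl-mono (∪-lub ∪ˡ (∪ʳ ∘ ∪ˡ)) ∘ spanning , (λ x∈ → cl-ext (∪ʳ (∪ʳ x∈))) ]′ ∘ ∪-case ,
          skew′
        where
        skew′ : ∀ {X g} → X ⊆ G → g ∈ G → Cl 𝒞 (X ∪ K ∪ ⁅ z ⁆) g → Cl 𝒞 X g
        skew′ {X} {g} X⊆G g∈G c with cl? (X ∪ K) g
        ... | yes c′ = skew X⊆G g∈G c′
        ... | no ¬c′ = ⊥-elim (¬c (cl-mono (∪-lub (∪-lub (∪ˡ ∘ X⊆G) ∪ʳ) (∪ˡ ∘ ⁅⁆⊆ g∈G))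
            (exchange (cl-mono (∪-lub (∪ˡ ∘ ∪ˡ) (∪-lub (∪ˡ ∘ ∪ʳ) ∪ʳ)) c) ¬c′)))
  ... | K , K⊆E , spanning , skew = rep-cong {𝒞 = 𝒞 / K} {𝒞} skew (λ _ _ → cl-mono ∪ˡ)
      (rep-transfer {𝒞 = 𝒞 / K} (λ g∈G → _ , G⊆E g∈G , self , self) parallel (rep-contract R K K⊆E))
    where
    module R = Rep R
    open Closure 𝒞 hiding (Cl)
    self : ∀ {x} → Cl (𝒞 / K) ⁅ x ⁆ x
    self = cl-ext (∪ˡ (x∈⁅x⁆ _))
    parallel : ∀ {u} → u ∈ E → ¬ Cl (𝒞 / K) ⊥ u → ∃ λ g → g ∈ G × Parallel (𝒞 / K) u g
    parallel {u} u∈E nonloop =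
      -- The component `a` of `u` along `G` is nonzero, since otherwise `u` would be spanned by `K`;
      -- the point on it belongs to the flat `G` and differs from `u` only by a vector spanned by
      -- `K`.
      let a , b , sa , sb , u≋a+b = span-split (R.cl⇒span (∪-lub G⊆E K⊆E) u∈E (spanning u∈E))
          a≢0 = λ z → nonloop (cl-mono ∪ʳ (R.span⇒cl K⊆E u∈E
            (span-resp (λ i → ≈-sym (≈-trans (u≋a+b i) (≈-trans (+-congʳ (z i)) (+-identityˡ (b i))))) sb)))
          g , g∈E , (c , a≋cg) , sg = R.point-of-span sa a≢0
          u∈g∪K = R.span⇒cl (∪-lub (⁅⁆⊆ g∈E) K⊆E) u∈E (span-resp (λ i → ≈-sym (u≋a+b i))
            (span-+ (span-multiple c (∪ˡ (x∈⁅x⁆ g)) a≋cg) (span-mono ∪ʳ sb)))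
      in g , R.span-flat flatG g∈E sg ,
        cl-mono (∪-lub ∪ʳ ∪ˡ) (exchange (cl-mono (∪-lub ∪ʳ ∪ˡ) u∈g∪K) (nonloop ∘ cl-mono ∪ʳ)) , u∈g∪K

  module _ {ρ : Subset m → ℕ} {𝒞 : Closure m} (rk : RankOf 𝒞 ρ) {E : Subset m} where
    open RankOf rk
    open Closure 𝒞 hiding (Cl)

    isPG⇒rep : IsPG F k (mat m E ρ) → Rep 𝒞 E
    isPG⇒rep {k} P = rep k vec
      (λ X⊆E e∈E c → let Y , Y⊆X , ind , eq = rank-ach _ X⊆E in
        span-mono Y⊆X (maximal-spans Y⊆X X⊆E e∈E c ind eq))
      span⇒cl covers
      where
      open IsPG P
      maximal-spans : ∀ {X Y e} → Y ⊆ X → X ⊆ E → e ∈ E → Cl 𝒞 X e →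
        LinIndep F vec Y → ∣ Y ∣ ≡ ρ X → Span vec Y (vec e)
      maximal-spans {X} {Y} {e} Y⊆X X⊆E e∈E c ind ∣Y∣≡ with span? vec Y (vec e)
      ... | yes s = s
      ... | no ¬s = ⊥-elim (ℕₚ.<-irrefl refl (begin-strict
          ∣ Y ∣           <⟨ ℕₚ.≤-reflexive (sym (∣X∪x∣≡1+∣X∣ (¬s ∘ span-gen))) ⟩
          ∣ Y ∪ ⁅ e ⁆ ∣   ≤⟨ rank-max (X ∪ ⁅ e ⁆) (∪-lub X⊆E (⁅⁆⊆ e∈E)) (Y ∪ ⁅ e ⁆)
                              (∪-lub (∪ˡ ∘ Y⊆X) ∪ʳ) (indep-∪ vec ind ¬s) ⟩
          ρ (X ∪ ⁅ e ⁆)   ≡⟨ cl⇒ c ⟩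
          ρ X             ≡⟨ ∣Y∣≡ ⟨
          ∣ Y ∣           ∎))
        where open ≤-Reasoning
      span⇒cl : ∀ {X e} → X ⊆ E → e ∈ E → Span vec X (vec e) → Cl 𝒞 X e
      span⇒cl {X} {e} X⊆E e∈E s with cl? X e | rank-ach X X⊆E
      ... | yes c | _ = c
      -- If `e` is not in the closure of `X`, then `Y ∪ ⁅ e ⁆` has rank one more than the size of
      -- `Y`, so the independent set attaining its rank must be all of it. But the vector of `e` is
      -- spanned by `X` and therefore by `Y`.
      ... | no ¬c | Y , Y⊆X , ind , ∣Y∣≡ρX
          with rank-ach (Y ∪ ⁅ e ⁆) (∪-lub (X⊆E ∘ Y⊆X) (⁅⁆⊆ e∈E))
      ... | Y′ , Y′⊆ , ind′ , ∣Y′∣≡ = ⊥-elim (indep-∉span vec e∉Y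
          (indep-⊆ vec (⊆∧∣∣≡⇒⊇ Y′⊆ size) ind′)
          (span-bind (λ x∈X → maximal-spans Y⊆X X⊆E (X⊆E x∈X) (cl-ext x∈X) ind ∣Y∣≡ρX) s))
        where
        e∉Y : e ∉ Y
        e∉Y = ¬c ∘ cl-ext ∘ Y⊆X
        ρY≡∣Y∣ : ρ Y ≡ ∣ Y ∣
        ρY≡∣Y∣ = ℕₚ.≤-antisym (bound Y) (rank-max Y (X⊆E ∘ Y⊆X) Y id ind)
        size : ∣ Y′ ∣ ≡ ∣ Y ∪ ⁅ e ⁆ ∣
        size = trans ∣Y′∣≡ (trans (¬cl⇒ (¬c ∘ cl-mono Y⊆X))
          (trans (cong suc ρY≡∣Y∣) (sym (∣X∪x∣≡1+∣X∣ e∉Y))))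

    isPG⇒simple : IsPG F k (mat m E ρ) → Simple 𝒞 E
    isPG⇒simple P =
      (λ e∈E c → nonzero _ e∈E (span-⊥ (R.cl⇒span (⊥-elim ∘ ∉⊥) e∈E c))) ,
      (λ e∈E f∈E c → distinct _ _ e∈E f∈E (R.cl⇒proportional e∈E f∈E c))
      where
      open IsPG P
      module R = Rep (isPG⇒rep P)

    rep⇒isPG : Simple 𝒞 E → Rep 𝒞 E → IsPGq q (mat m E ρ)
    rep⇒isPG (loopless , no-parallel) R = F , R.dim , record
      { vec = R.vec
      ; nonzero = λ e e∈E → R.nonloop e∈E (loopless e∈E)
      ; distinct = λ e f e∈E f∈E ∝ → no-parallel e∈E f∈E (R.proportional⇒cl e∈E f∈E ∝)
      ; covers = R.covers
      ; rank-ach = λ X X⊆E → let Y , Y⊆X , ρY≡∣Y∣ , ρY≡ρX = basis rk X in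
          Y , Y⊆X , indep-from-span R.vec (λ {y} y∈Y s → independent Y ρY≡∣Y∣ y∈Y
            (R.span⇒cl (X⊆E ∘ Y⊆X ∘ p─q⊆p Y ⁅ y ⁆) (X⊆E (Y⊆X y∈Y)) s)) ,
          trans (sym ρY≡∣Y∣) ρY≡ρX
      ; rank-max = λ X X⊆E Y Y⊆X ind → ℕₚ.≤-trans (indep-rank Y (X⊆E ∘ Y⊆X) ind) (mono Y⊆X)
      }
      where
      module R = Rep R
      independent : ∀ Y → ρ Y ≡ ∣ Y ∣ → ∀ {y} → y ∈ Y → ¬ Cl 𝒞 (Y ─ ⁅ y ⁆) y
      independent Y ρY≡∣Y∣ {y} y∈Y c = ℕₚ.<-irrefl refl (begin-strict
        ρ Y                       ≤⟨ mono cover ⟩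
        ρ ((Y ─ ⁅ y ⁆) ∪ ⁅ y ⁆)   ≡⟨ cl⇒ c ⟩
        ρ (Y ─ ⁅ y ⁆)             ≤⟨ bound (Y ─ ⁅ y ⁆) ⟩
        ∣ Y ─ ⁅ y ⁆ ∣             <⟨ x∈p⇒∣p-x∣<∣p∣ y∈Y ⟩
        ∣ Y ∣                     ≡⟨ ρY≡∣Y∣ ⟨
        ρ Y                       ∎)
        where
        open ≤-Reasoning
        cover : Y ⊆ (Y ─ ⁅ y ⁆) ∪ ⁅ y ⁆
        cover {x} x∈Y with x ≟ y
        ... | yes refl = ∪ʳ (x∈⁅x⁆ y)
        ... | no x≢y = ∪ˡ (x∈p∧x≢y⇒x∈p-y x∈Y x≢y)
      indep-rank : ∀ Y → Y ⊆ E → LinIndep F R.vec Y → ∣ Y ∣ ≤ ρ Y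
      indep-rank = subset-induction (λ Y → Y ⊆ E → LinIndep F R.vec Y → ∣ Y ∣ ≤ ρ Y)
        (λ _ _ → subst (_≤ ρ ⊥) (sym (∣⊥∣≡0 m)) z≤n) step
        where
        step : ∀ Y y → (Y ⊆ E → LinIndep F R.vec Y → ∣ Y ∣ ≤ ρ Y) →
          Y ∪ ⁅ y ⁆ ⊆ E → LinIndep F R.vec (Y ∪ ⁅ y ⁆) → ∣ Y ∪ ⁅ y ⁆ ∣ ≤ ρ (Y ∪ ⁅ y ⁆)
        step Y y ih Y∪y⊆E ind with y ∈? Y
        ... | yes y∈Y = subst (λ Z → ∣ Z ∣ ≤ ρ Z) (⊆-antisym ∪ˡ (∪-lub id (⁅⁆⊆ y∈Y)))
            (ih (Y∪y⊆E ∘ ∪ˡ) (indep-⊆ R.vec ∪ˡ ind))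
        ... | no y∉Y = begin
          ∣ Y ∪ ⁅ y ⁆ ∣   ≡⟨ ∣X∪x∣≡1+∣X∣ y∉Y ⟩
          suc ∣ Y ∣       ≤⟨ s≤s (ih (Y∪y⊆E ∘ ∪ˡ) (indep-⊆ R.vec ∪ˡ ind)) ⟩
          suc (ρ Y)       ≡⟨ ¬cl⇒ (λ c → indep-∉span R.vec y∉Y ind
                               (R.cl⇒span (Y∪y⊆E ∘ ∪ˡ) (Y∪y⊆E (∪ʳ (x∈⁅x⁆ y))) c)) ⟨
          ρ (Y ∪ ⁅ y ⁆)   ∎
          where open ≤-Reasoning

-- Lines have exactly q + 1 points

module _ {F : FiniteField q} {𝒞 : Closure m} {E : Subset m} (R : Representation.Rep F 𝒞 E)
  (simple : Simple 𝒞 E) {s t : Fin m} (s∈E : s ∈ E) (t∈E : t ∈ E) where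
  open FiniteField F hiding (_-_; zero) renaming (refl to ≈-refl; sym to ≈-sym; trans to ≈-trans)
  open LinearAlgebra F
  open Representation F
  open Rep R
  open Closure 𝒞
  open Relation.Binary.Reasoning.Setoid setoid

  private
    on-line : Fin q → V dim
    on-line i j = vec s j + enum i * vec t j

    pair⊆E : ⁅ s ⁆ ∪ ⁅ t ⁆ ⊆ E
    pair⊆E = ∪-lub (⁅⁆⊆ s∈E) (⁅⁆⊆ t∈E)

    -- The `q + 1` labels are those of a projective line: `zero` for the point `t` at infinity, and
    -- one for each affine point given by the vector of `s` plus a multiple of that of `t`.
    Code : Fin m → Fin (suc q) → Set
    Code x zero = Span vec ⁅ t ⁆ (vec x)
    Code x (suc i) = Proportional F (vec x) (on-line i)

    code-injective : ∀ {x y} c → x ∈ E → y ∈ E → Code x c → Code y c → x ≡ y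
    code-injective zero x∈E y∈E cx cy =
      trans (proj₂ simple x∈E t∈E (span⇒cl (⁅⁆⊆ t∈E) x∈E cx))
        (sym (proj₂ simple y∈E t∈E (span⇒cl (⁅⁆⊆ t∈E) y∈E cy)))
    code-injective {x} {y} (suc i) x∈E y∈E (a , x≋) cy =
      let b , z≋by = proportional-sym (nonloop y∈E (proj₁ simple y∈E)) cy in
      proj₂ simple x∈E y∈E (proportional⇒cl x∈E y∈E (a * b , λ j →
        ≈-trans (x≋ j) (≈-trans (*-congˡ (z≋by j)) (≈-sym (*-assoc a b (vec y j))))))

    code : ∀ {x} → x ∈ E → Cl (⁅ s ⁆ ∪ ⁅ t ⁆) x → ∃ (Code x)
    code {x} x∈E c =
      let u , v , su , sv , x≋u+v = span-split (cl⇒span pair⊆E x∈E c)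
          a , u≋as = span-⁅⁆ su
          b , v≋bt = span-⁅⁆ sv
      in decide a b λ j → ≈-trans (x≋u+v j) (+-cong (u≋as j) (v≋bt j))
      where
      normalise : ∀ a b → (∀ j → vec x j ≈ a * vec s j + b * vec t j) → ¬ (a ≈ 0#) →
        ∃ λ i → Proportional F (vec x) (on-line i)
      normalise a b eq a≉0 =
        let d , ad≈1 = inverse a a≉0
            i , i≈db = enum-sur (d * b)
        in i , a , λ j → ≈-trans (eq j) (≈-trans (+-congˡ (≈-trans (≈-sym (*-identityˡ (b * vec t j)))
          (≈-trans (*-congʳ (≈-sym ad≈1)) (≈-trans (*-assoc a d (b * vec t j)) (*-congˡ
            (≈-trans (≈-sym (*-assoc d b (vec t j))) (*-congʳ (≈-sym i≈db))))))))
          (≈-sym (distribˡ a (vec s j) (enum i * vec t j))))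
      decide : ∀ a b → (∀ j → vec x j ≈ a * vec s j + b * vec t j) → ∃ (Code x)
      decide a b eq with a ≈? 0#
      ... | yes a≈0 = zero , span-multiple b (x∈⁅x⁆ t) λ j →
            ≈-trans (eq j) (≈-trans (+-congʳ (≈-trans (*-congʳ a≈0) (zeroˡ (vec s j)))) (+-identityˡ _))
      ... | no a≉0 = let i , p = normalise a b eq a≉0 in suc i , p

  at-most-q+1-points : (h : Fin (suc (suc q)) → Fin m) → (∀ i → h i ∈ E) →
    (∀ i → Cl (⁅ s ⁆ ∪ ⁅ t ⁆) (h i)) → ∃₂ λ i j → i ≢ j × h i ≡ h j
  at-most-q+1-points h h∈E h-line =
    let i , j , i<j , eq = pigeonhole (ℕₚ.n<1+n (suc q)) (λ i → proj₁ (code (h∈E i) (h-line i)))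
    in i , j , <⇒≢ i<j , code-injective _ (h∈E i) (h∈E j) (proj₂ (code (h∈E i) (h-line i)))
      (subst (Code (h j)) (sym eq) (proj₂ (code (h∈E j) (h-line j))))

  at-least-q+1-points : s ≢ t → Σ (Fin (suc q) → Fin m) λ g →
    (∀ i → g i ∈ E) × (∀ i → Cl (⁅ s ⁆ ∪ ⁅ t ⁆) (g i)) × (∀ i j → g i ≡ g j → i ≡ j)
  at-least-q+1-points s≢t = g , g∈E , g-line , g-inj
    where
    s∉t : ∀ {w} → Span vec ⁅ t ⁆ w → ¬ (vec s ≋ w)
    s∉t sw eq = s≢t (proj₂ simple s∈E t∈E
      (span⇒cl (⁅⁆⊆ t∈E) s∈E (span-resp (λ j → ≈-sym (eq j)) sw)))
    s-on-line : ∀ {X} i → Span vec X (on-line i) → Span vec X (vec t) → Span vec X (vec s)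
    s-on-line i sl st = 
      span-cancelˡ {w = on-line i} {λ j → enum i * vec t j} {vec s}
        (λ j → +-comm (vec s j) (enum i * vec t j)) sl (span-· (enum i) st)
    line≢0 : ∀ i → NonZeroVec F (on-line i)
    line≢0 i z = s∉t (s-on-line i (nil z) (span-gen (x∈⁅x⁆ t))) (λ _ → ≈-refl)
    point-at : ∀ i → ∃ λ e → e ∈ E × Proportional F (on-line i) (vec e)
    point-at i = covers (on-line i) (line≢0 i)
    g : Fin (suc q) → Fin m
    g zero = t
    g (suc i) = proj₁ (point-at i)
    g∈E : ∀ i → g i ∈ E
    g∈E zero = t∈E
    g∈E (suc i) = proj₁ (proj₂ (point-at i))
    g-line : ∀ i → Cl (⁅ s ⁆ ∪ ⁅ t ⁆) (g i)
    g-line zero = cl-ext (∪ʳ (x∈⁅x⁆ t))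
    g-line (suc i) = span⇒cl pair⊆E (g∈E (suc i))
      (span-proportional (proportional-sym (line≢0 i) (proj₂ (proj₂ (point-at i))))
        (span-+ (span-gen (∪ˡ (x∈⁅x⁆ s))) (span-multiple (enum i) (∪ʳ (x∈⁅x⁆ t)) λ _ → ≈-refl)))
    line∈ : ∀ i {e} → e ≡ g (suc i) → Span vec ⁅ e ⁆ (on-line i)
    line∈ i refl = span-proportional (proj₂ (proj₂ (point-at i))) (span-gen (x∈⁅x⁆ _))
    t≢g : ∀ i → t ≢ g (suc i)
    t≢g i t≡g = s∉t (s-on-line i (line∈ i t≡g) (span-gen (x∈⁅x⁆ t))) (λ _ → ≈-refl)
    difference : ∀ i j → on-line i ≋ (λ x → on-line j x + (enum i + - enum j) * vec t x)
    difference i j x = begin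
      vec s x + enum i * vec t x
        ≈⟨ +-congˡ (add-subtract (enum j) (vec t x) (enum i * vec t x)) ⟩
      vec s x + (enum j * vec t x + (enum i * vec t x + (- enum j) * vec t x))
        ≈⟨ +-assoc (vec s x) (enum j * vec t x) _ ⟨
      on-line j x + (enum i * vec t x + (- enum j) * vec t x)
        ≈⟨ +-congˡ (distribʳ (vec t x) (enum i) (- enum j)) ⟨
      on-line j x + (enum i + - enum j) * vec t x ∎
    -- A point carrying two different affine vectors also carries their difference, a nonzero
    -- multiple of the vector of `t`. By simplicity it would equal `t`, which `t≢g` excludes.
    g-inj′ : ∀ i j → g (suc i) ≡ g (suc j) → i ≡ j
    g-inj′ i j eq = decidable-stable (i ≟ j) λ i≢j → t≢g i (proj₂ simple t∈E (g∈E (suc i))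
        (span⇒cl (⁅⁆⊆ (g∈E (suc i))) t∈E (t∈span i≢j)))
      where
      e : Carrier
      e = enum i + - enum j
      e≉0 : i ≢ j → ¬ (e ≈ 0#)
      e≉0 i≢j e≈0 = i≢j (enum-inj i j (begin
        enum i                       ≈⟨ +-identityʳ (enum i) ⟨
        enum i + 0#                  ≈⟨ +-congˡ (-‿inverseˡ (enum j)) ⟨
        enum i + (- enum j + enum j) ≈⟨ +-assoc (enum i) (- enum j) (enum j) ⟨
        e + enum j                   ≈⟨ +-congʳ e≈0 ⟩
        0# + enum j                  ≈⟨ +-identityˡ (enum j) ⟩
        enum j                       ∎))
      t∈span : i ≢ j → Span vec ⁅ g (suc i) ⁆ (vec t)
      t∈span i≢j = let d , ed≈1 = inverse e (e≉0 i≢j) in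
        span-proportional (d , λ x → cancel-inverse {x = vec t x} {y = e * vec t x} ed≈1 ≈-refl)
          (span-cancelˡ {w = on-line i} {on-line j} {λ x → e * vec t x}
            (difference i j) (line∈ i refl) (line∈ j eq))
    g-inj : ∀ i j → g i ≡ g j → i ≡ j
    g-inj zero zero _ = refl
    g-inj zero (suc j) eq = ⊥-elim (t≢g j eq)
    g-inj (suc i) zero eq = ⊥-elim (t≢g i (sym eq))
    g-inj (suc i) (suc j) eq = cong suc (g-inj′ i j eq)

-- The two geometries need not be given over the same field: a line of T has as many points as
-- the line of E containing it.
sub-PG-flat : {F F′ : FiniteField q} {𝒞 : Closure m} {E T : Subset m} → T ⊆ E → Simple 𝒞 E →
  Representation.Rep F 𝒞 E → Representation.Rep F′ 𝒞 T → Closure.FlatIn 𝒞 E T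
sub-PG-flat {q} {m} {F} {F′} {𝒞} {E} {T} T⊆E simple R R′ = T⊆E , closed
  where
  open LinearAlgebra F
  open Representation F
  open Rep R
  open Closure 𝒞
  simpleT : Simple 𝒞 T
  simpleT = proj₁ simple ∘ T⊆E , λ e∈T f∈T → proj₂ simple (T⊆E e∈T) (T⊆E f∈T)

  line-closed : ∀ {s t p} → s ∈ T → t ∈ T → p ∈ E → Cl (⁅ s ⁆ ∪ ⁅ t ⁆) p → p ∈ T
  line-closed {s} {t} {p} s∈T t∈T p∈E c with s ≟ t
  ... | yes refl = subst (_∈ T) (sym (proj₂ simple p∈E (T⊆E s∈T) (cl-mono (∪-lub id id) c))) s∈T
  ... | no s≢t with p ∈? T
  ... | yes p∈T = p∈T
  ... | no p∉T = ⊥-elim (distinct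
      (at-most-q+1-points R simple (T⊆E s∈T) (T⊆E t∈T) h h∈E h-line))
    where
    points : Σ (Fin (suc q) → Fin m) λ g →
      (∀ i → g i ∈ T) × (∀ i → Cl (⁅ s ⁆ ∪ ⁅ t ⁆) (g i)) × (∀ i j → g i ≡ g j → i ≡ j)
    points = at-least-q+1-points R′ simpleT s∈T t∈T s≢t
    g : Fin (suc q) → Fin m
    g = proj₁ points
    h : Fin (suc (suc q)) → Fin m
    h zero = p
    h (suc i) = g i
    h∈E : ∀ i → h i ∈ E
    h∈E zero = p∈E
    h∈E (suc i) = T⊆E (proj₁ (proj₂ points) i)
    h-line : ∀ i → Cl (⁅ s ⁆ ∪ ⁅ t ⁆) (h i)
    h-line zero = c
    h-line (suc i) = proj₁ (proj₂ (proj₂ points)) i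
    distinct : ¬ (∃₂ λ i j → i ≢ j × h i ≡ h j)
    distinct (zero , zero , i≢j , _) = i≢j refl
    distinct (zero , suc j , _ , eq) = p∉T (subst (_∈ T) (sym eq) (proj₁ (proj₂ points) j))
    distinct (suc i , zero , _ , eq) = p∉T (subst (_∈ T) eq (proj₁ (proj₂ points) i))
    distinct (suc i , suc j , i≢j , eq) = i≢j (cong suc (proj₂ (proj₂ (proj₂ points)) i j eq))

  -- Closure under lines suffices for closure under spans: a sum is evaluated one term at a time,
  -- and each nonzero partial sum is a point on the line through two points of `T`.
  span-point : ∀ {w} → Span vec T w → NonZeroVec F w → ∃ λ t → t ∈ T × Proportional F w (vec t)
  span-point (nil z) w≢0 = ⊥-elim (w≢0 z)
  span-point {w} (add c {e} {w′} e∈T s eq) w≢0 with ≋0? w′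
  ... | yes z = e , e∈T , c , λ i → K.trans (eq i) (K.trans (K.+-congˡ (z i)) (K.+-identityʳ _))
    where module K = FiniteField F
  ... | no w′≢0 =
    let t , t∈T , d , w′≋dt = span-point s w′≢0
        w∈line = add c (∪ˡ (x∈⁅x⁆ e)) (span-multiple d (∪ʳ (x∈⁅x⁆ t)) w′≋dt) eq
        p , p∈E , w∝p , sp = point-of-span w∈line w≢0
    in p , line-closed e∈T t∈T p∈E
      (span⇒cl (∪-lub (⁅⁆⊆ (T⊆E e∈T)) (⁅⁆⊆ (T⊆E t∈T))) p∈E sp) , w∝p

  closed : ∀ {f} → f ∈ E → Cl T f → f ∈ T
  closed {f} f∈E c =
    let t , t∈T , f∝t = span-point (cl⇒span T⊆E f∈E c) (nonloop f∈E (proj₁ simple f∈E))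
    in subst (_∈ T) (sym (proj₂ simple f∈E (T⊆E t∈T) (proportional⇒cl f∈E (T⊆E t∈T) f∝t))) t∈T

-- Chordality depends only on the ranks of subsets of the ground set

Agree : Subset m → (ρ ρ′ : Subset m → ℕ) → Set
Agree E ρ ρ′ = ∀ {X} → X ⊆ E → ρ X ≡ ρ′ X

module _ {E : Subset m} {ρ ρ′ : Subset m → ℕ} (agree : Agree E ρ ρ′) where
  open Nat using (_+_)

  isMatroid-resp : IsMatroid (mat m E ρ) → IsMatroid (mat m E ρ′)
  isMatroid-resp M = record
    { r-bound = λ X X⊆E → subst (_≤ ∣ X ∣) (agree X⊆E) (r-bound X X⊆E)
    ; r-mono = λ X Y X⊆Y Y⊆E → subst₂ _≤_ (agree (Y⊆E ∘ X⊆Y)) (agree Y⊆E) (r-mono X Y X⊆Y Y⊆E)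
    ; r-submod = λ X Y X⊆E Y⊆E → subst₂ _≤_
        (cong₂ _+_ (agree (∪-lub X⊆E Y⊆E)) (agree (X⊆E ∘ ∩ˡ))) (cong₂ _+_ (agree X⊆E) (agree Y⊆E))
        (r-submod X Y X⊆E Y⊆E)
    }
    where open IsMatroid M

  isPGq-resp : IsPGq q (mat m E ρ) → IsPGq q (mat m E ρ′)
  isPGq-resp (F , k , P) = F , k , record
    { vec = vec
    ; nonzero = nonzero
    ; distinct = distinct
    ; covers = covers
    ; rank-ach = λ X X⊆E → let Y , Y⊆X , ind , eq = rank-ach X X⊆E in
        Y , Y⊆X , ind , trans eq (agree X⊆E)
    ; rank-max = λ X X⊆E Y Y⊆X ind → subst (∣ Y ∣ ≤_) (agree X⊆E) (rank-max X X⊆E Y Y⊆X ind)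
    }
    where open IsPG P

  flat-resp : ∀ {X} → Flat (mat m E ρ) X → Flat (mat m E ρ′) X
  flat-resp (X⊆E , flat) = X⊆E , λ e e∈E e∉X →
    subst₂ _<_ (agree X⊆E) (agree (∪-lub X⊆E (⁅⁆⊆ e∈E))) (flat e e∈E e∉X)

modularFlat-resp : ∀ {E T : Subset m} {ρ ρ′} → Agree E ρ ρ′ →
  ModularFlat (mat m E ρ) T → ModularFlat (mat m E ρ′) T
modularFlat-resp agree (flatT@(T⊆E , _) , mod) = flat-resp agree flatT , λ F flatF@(F⊆E , _) →
  subst₂ _≡_ (cong₂ Nat._+_ (agree (∪-lub T⊆E F⊆E)) (agree (T⊆E ∘ ∩ˡ))) (cong₂ Nat._+_ (agree T⊆E) (agree F⊆E))
    (mod F (flat-resp (λ X⊆E → sym (agree X⊆E)) flatF))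

chordal-resp : ∀ {E : Subset m} {ρ ρ′} → Agree E ρ ρ′ →
  Chordal q (mat m E ρ) → Chordal q (mat m E ρ′)
chordal-resp agree (pg _ M P) = pg _ (isMatroid-resp agree M) (isPGq-resp agree P)
chordal-resp {m} {E = E} {ρ} {ρ′} agree (gpc _ E₁ E₂ M E≡ c₁ c₂ mod P flats) =
  gpc _ E₁ E₂ (isMatroid-resp agree M) E≡ (chordal-resp agree₁ c₁) (chordal-resp agree₂ c₂)
    (modularFlat-resp agree₁ mod) (isPGq-resp (λ X⊆ → agree₁ (∩ˡ ∘ X⊆)) P)
    λ X X⊆E →
      (λ flat → let f₁ , f₂ = proj₁ (flats X X⊆E) (flat-resp (λ Y⊆ → sym (agree Y⊆)) flat) in
        flat-resp agree₁ f₁ , flat-resp agree₂ f₂) ,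
      (λ (f₁ , f₂) → flat-resp agree (proj₂ (flats X X⊆E)
        (flat-resp (λ Y⊆ → sym (agree₁ Y⊆)) f₁ , flat-resp (λ Y⊆ → sym (agree₂ Y⊆)) f₂)))
  where
  agree₁ : Agree E₁ ρ ρ′
  agree₁ X⊆ = agree (λ x∈X → subst (_ ∈_) (sym E≡) (∪ˡ (X⊆ x∈X)))
  agree₂ : Agree E₂ ρ ρ′
  agree₂ X⊆ = agree (λ x∈X → subst (_ ∈_) (sym E≡) (∪ʳ (X⊆ x∈X)))

chordal⇒isMatroid : ∀ {M} → Chordal q M → IsMatroid M
chordal⇒isMatroid (pg _ M _) = M
chordal⇒isMatroid (gpc _ _ _ M _ _ _ _ _ _) = M

-- Gluing along E₁ ∩ E₂

-- Only one direction of the description of flats is recorded; that a flat of `E` meets subsets of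
-- `E` in flats is `flat-∩`. Modularity of the intersection is kept apart, which makes the notion
-- symmetric in the two parts.
record Glue (𝒞 : Closure m) (E E₁ E₂ : Subset m) : Set where
  open Closure 𝒞
  field
    E≡E₁∪E₂ : E ≡ E₁ ∪ E₂
    flat    : ∀ {X} → X ⊆ E → FlatIn E₁ (X ∩ E₁) → FlatIn E₂ (X ∩ E₂) → FlatIn E X

  E₁⊆E : E₁ ⊆ E
  E₁⊆E e∈ = subst (_ ∈_) (sym E≡E₁∪E₂) (∪ˡ e∈)

  E₂⊆E : E₂ ⊆ E
  E₂⊆E e∈ = subst (_ ∈_) (sym E≡E₁∪E₂) (∪ʳ e∈)

  split : ∀ {e} → e ∈ E → e ∈ E₁ ⊎ e ∈ E₂
  split e∈ = ∪-case (subst (_ ∈_) E≡E₁∪E₂ e∈)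

glue-sym : ∀ {𝒞 : Closure m} {E E₁ E₂} → Glue 𝒞 E E₁ E₂ → Glue 𝒞 E E₂ E₁
glue-sym {E₁ = E₁} {E₂} G = record
  { E≡E₁∪E₂ = trans (Glue.E≡E₁∪E₂ G) (∪-comm E₁ E₂)
  ; flat = λ X⊆E f₂ f₁ → Glue.flat G X⊆E f₁ f₂
  }

-- A flat `U` containing `Z` and `X` is built by hand: close `Z` in `E₂` to get `Z′`, then close in
-- `E₁` what `Z′` and `X` contribute there to get `W`. Modularity of `E₁ ∩ E₂` in `E₁` ensures that
-- `W` adds nothing to `E₂` beyond `Z′`, so `U` meets both parts in flats, and whatever `Z ∪ X`
-- spans inside `E₂` is already in `Z′`.
glue-modular : ∀ {𝒞 : Closure m} {E E₁ E₂} → Glue 𝒞 E E₁ E₂ →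
  Closure.ModularIn 𝒞 E₁ (E₁ ∩ E₂) → Closure.ModularIn 𝒞 E E₂
glue-modular {m} {𝒞} {E} {E₁} {E₂} G (flatT , modT) =
  flat E₂⊆E (subst (FlatIn E₁) (∩-comm E₁ E₂) flatT)
    (∩ˡ , λ e∈E₂ _ → ∩⁺ e∈E₂ e∈E₂) ,
  mod
  where
  open Glue G
  open Closure 𝒞
  mod : ∀ X → FlatIn E X → ∀ Z → Z ⊆ E₂ → E₂ ∩ X ⊆ Z → ∀ {t} → t ∈ E₂ → Cl (Z ∪ X) t → Cl Z t
  mod X flatX@(X⊆E , _) Z Z⊆E₂ E₂∩X⊆Z {t} t∈E₂ c =
    clIn⁻ (subst (t ∈_) U∩E₂ (∩⁺ (proj₂ flatU (E₂⊆E t∈E₂) (cl-mono (∪-lub (∪ˡ ∘ Z⊆Z′) X⊆U) c)) t∈E₂))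
    where
    Z′ W U : Subset m
    Z′ = clIn E₂ Z
    W = clIn E₁ ((Z′ ∩ E₁) ∪ (X ∩ E₁))
    U = Z′ ∪ W
    Z⊆Z′ : Z ⊆ Z′
    Z⊆Z′ z∈ = clIn⁺ (Z⊆E₂ z∈) (cl-ext z∈)
    U∩E₁ : U ∩ E₁ ≡ W
    U∩E₁ = ⊆-antisym
      (λ p → [ (λ y∈Z′ → clIn⁺ (∩ʳ p) (cl-ext (∪ˡ (∩⁺ y∈Z′ (∩ʳ p))))) , id ]′ (∪-case (∩ˡ p)))
      (λ y∈W → ∩⁺ (∪ʳ y∈W) (clIn-⊆ y∈W))
    W∩E₂⊆Z′ : ∀ {y} → y ∈ W → y ∈ E₂ → y ∈ Z′
    W∩E₂⊆Z′ y∈W y∈E₂ = proj₂ (clIn-flat E₂ Z) y∈E₂ (cl-mono ∩ˡ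
      (modT (X ∩ E₁) (flat-∩ flatX E₁⊆E) (Z′ ∩ E₁)
        (λ p → ∩⁺ (∩ʳ p) (clIn-⊆ (∩ˡ p)))
        (λ p → ∩⁺ (Z⊆Z′ (E₂∩X⊆Z (∩⁺ (∩ʳ (∩ˡ p)) (∩ˡ (∩ʳ p))))) (∩ˡ (∩ˡ p)))
        (∩⁺ (clIn-⊆ y∈W) y∈E₂) (clIn⁻ y∈W)))
    U∩E₂ : U ∩ E₂ ≡ Z′
    U∩E₂ = ⊆-antisym
      (λ p → [ id , (λ y∈W → W∩E₂⊆Z′ y∈W (∩ʳ p)) ]′ (∪-case (∩ˡ p)))
      (λ y∈Z′ → ∩⁺ (∪ˡ y∈Z′) (clIn-⊆ y∈Z′))
    flatU : FlatIn E U
    flatU = flat (∪-lub (E₂⊆E ∘ clIn-⊆) (E₁⊆E ∘ clIn-⊆))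
      (subst (FlatIn E₁) (sym U∩E₁) (clIn-flat E₁ _)) (subst (FlatIn E₂) (sym U∩E₂) (clIn-flat E₂ _))
    X⊆U : X ⊆ U
    X⊆U x∈X = [ (λ x∈E₁ → ∪ʳ (clIn⁺ x∈E₁ (cl-ext (∪ʳ (∩⁺ x∈X x∈E₁))))) ,
                (λ x∈E₂ → ∪ˡ (Z⊆Z′ (E₂∩X⊆Z (∩⁺ x∈E₂ x∈X)))) ]′ (split (X⊆E x∈X))

-- Modular flats of chordal matroids and restriction to flats

module _ {ρ : Subset m → ℕ} {𝒞 : Closure m} (rk : RankOf 𝒞 ρ) where
  open RankOf rk
  open Closure 𝒞

  glue⇒chordal : ∀ {E E₁ E₂} → Glue 𝒞 E E₁ E₂ →
    Chordal q (mat m E₁ ρ) → Chordal q (mat m E₂ ρ) →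
    ModularIn E₁ (E₁ ∩ E₂) → IsPGq q (mat m (E₁ ∩ E₂) ρ) → Chordal q (mat m E ρ)
  glue⇒chordal {E = E} {E₁} {E₂} G c₁ c₂ mod P =
    gpc _ E₁ E₂ (isMatroid E) E≡E₁∪E₂ c₁ c₂ (ModularIn⇒ModularFlat mod) P λ X X⊆E →
      (λ f → FlatIn⇒Flat (flat-∩ (Flat⇒FlatIn f) E₁⊆E) , FlatIn⇒Flat (flat-∩ (Flat⇒FlatIn f) E₂⊆E)) ,
      (λ (f₁ , f₂) → FlatIn⇒Flat (flat X⊆E (Flat⇒FlatIn f₁) (Flat⇒FlatIn f₂)))
    where open Glue G

  flats⇒glue : ∀ {E E₁ E₂} → E ≡ E₁ ∪ E₂ →
    (∀ X → X ⊆ E →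
      (Flat (mat m E ρ) X → Flat (mat m E₁ ρ) (X ∩ E₁) × Flat (mat m E₂ ρ) (X ∩ E₂)) ×
      (Flat (mat m E₁ ρ) (X ∩ E₁) × Flat (mat m E₂ ρ) (X ∩ E₂) → Flat (mat m E ρ) X)) →
    Glue 𝒞 E E₁ E₂
  flats⇒glue E≡ flats = record
    { E≡E₁∪E₂ = E≡
    ; flat = λ X⊆E f₁ f₂ → Flat⇒FlatIn (proj₂ (flats _ X⊆E) (FlatIn⇒Flat f₁ , FlatIn⇒Flat f₂))
    }

  PG⇒modular : ∀ {E T} → Chordal q (mat m E ρ) → T ⊆ E → IsPGq q (mat m T ρ) → ModularIn E T
  -- That `E₂` is modular uses the modularity given in `E₁`. For `E₁` the same argument needs
  -- `E₁ ∩ E₂` to be modular in `E₂`, which is `PG⇒modular` for the smaller chordal matroid on `E₂`;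
  -- hence the mutual recursion.
  parts-modular : ∀ {E E₁ E₂} → Glue 𝒞 E E₁ E₂ → Chordal q (mat m E₂ ρ) →
    ModularFlat (mat m E₁ ρ) (E₁ ∩ E₂) → IsPGq q (mat m (E₁ ∩ E₂) ρ) →
    ModularIn E E₁ × ModularIn E E₂

  PG⇒modular (pg _ _ (F , k , P)) T⊆E (F′ , k′ , P′) =
    Rep.flat⇒modular R (sub-PG-flat T⊆E (isPG⇒simple rk P) R (Representation.isPG⇒rep F′ rk P′))
    where
    open Representation F
    R : Rep 𝒞 _
    R = isPG⇒rep rk P
  PG⇒modular {E = E} {T} (gpc _ E₁ E₂ _ E≡ c₁ c₂ mod P flats) T⊆E PT@(F , k , P′) =
    [ (λ (T⊆E₁ : T ⊆ E₁ ∩ T) → modular-trans mod₁ (PG⇒modular c₁ (∩ˡ ∘ T⊆E₁) PT)) ,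
      (λ (T⊆E₂ : T ⊆ E₂ ∩ T) → modular-trans mod₂ (PG⇒modular c₂ (∩ˡ ∘ T⊆E₂) PT)) ]′
    (Representation.Rep.not-union-of-proper-flats (Representation.isPG⇒rep F rk P′)
      (flat-∩ (proj₁ mod₁) T⊆E) (flat-∩ (proj₁ mod₂) T⊆E)
      λ t∈T → [ (λ p → ∪ˡ (∩⁺ p t∈T)) , (λ p → ∪ʳ (∩⁺ p t∈T)) ]′ (Glue.split G (T⊆E t∈T)))
    where
    G : Glue 𝒞 E E₁ E₂
    G = flats⇒glue E≡ flats
    mod₁ : ModularIn E E₁
    mod₁ = proj₁ (parts-modular G c₂ mod P)
    mod₂ : ModularIn E E₂
    mod₂ = proj₂ (parts-modular G c₂ mod P)

  parts-modular {E₁ = E₁} {E₂} G c₂ mod P =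
    glue-modular (glue-sym G) (subst (ModularIn E₂) (∩-comm E₁ E₂) (PG⇒modular c₂ ∩ʳ P)) ,
    glue-modular G (ModularFlat⇒ModularIn mod)

  PG-flat : ∀ {E G} → FlatIn E G → IsPGq q (mat m E ρ) → IsPGq q (mat m G ρ)
  PG-flat flatG@(G⊆E , _) (F , k , P) = rep⇒isPG rk
    (proj₁ simple ∘ G⊆E , λ e∈G f∈G → proj₂ simple (G⊆E e∈G) (G⊆E f∈G)) (rep-flat flatG (isPG⇒rep rk P))
    where
    open Representation F
    simple : Simple 𝒞 _
    simple = isPG⇒simple rk P

  chordal-flat : ∀ {E F} → FlatIn E F → Chordal q (mat m E ρ) → Chordal q (mat m F ρ)
  chordal-flat flatF (pg _ _ P) = pg _ (isMatroid _) (PG-flat flatF P)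
  chordal-flat {E = E} {F} flatF@(F⊆E , _) (gpc _ E₁ E₂ _ E≡ c₁ c₂ mod P flats) =
    glue⇒chordal G′ (chordal-flat flat₁ c₁) (chordal-flat flat₂ c₂)
      (subst (ModularIn F₁) F₁∩T (modular-∩flat (ModularFlat⇒ModularIn mod) flat₁))
      (PG-flat (subst (FlatIn (E₁ ∩ E₂)) F₁∩T (flat-∩ flat₁ ∩ˡ)) P)
    where
    G : Glue 𝒞 E E₁ E₂
    G = flats⇒glue E≡ flats
    open Glue G
    F₁ F₂ : Subset m
    F₁ = F ∩ E₁
    F₂ = F ∩ E₂
    flat₁ : FlatIn E₁ F₁
    flat₁ = flat-∩ flatF E₁⊆E
    flat₂ : FlatIn E₂ F₂
    flat₂ = flat-∩ flatF E₂⊆E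
    F₁∩T : F₁ ∩ (E₁ ∩ E₂) ≡ F₁ ∩ F₂
    F₁∩T = ⊆-antisym (λ p → ∩⁺ (∩ˡ p) (∩⁺ (∩ˡ (∩ˡ p)) (∩ʳ (∩ʳ p))))
                     (λ p → ∩⁺ (∩ˡ p) (∩⁺ (∩ʳ (∩ˡ p)) (∩ʳ (∩ʳ p))))
    restrict : ∀ {X D} → X ⊆ F → X ∩ (F ∩ D) ≡ X ∩ D
    restrict X⊆F = ⊆-antisym (λ p → ∩⁺ (∩ˡ p) (∩ʳ (∩ʳ p))) (λ p → ∩⁺ (∩ˡ p) (∩⁺ (X⊆F (∩ˡ p)) (∩ʳ p)))
    G′ : Glue 𝒞 F F₁ F₂
    G′ = record
      { E≡E₁∪E₂ = ⊆-antisym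
          (λ f∈F → [ ∪ˡ ∘ ∩⁺ f∈F , ∪ʳ ∘ ∩⁺ f∈F ]′ (split (F⊆E f∈F))) (∪-lub ∩ˡ ∩ˡ)
      ; flat = λ X⊆F f₁ f₂ → flat-⊆ (flat (F⊆E ∘ X⊆F)
          (subst (FlatIn E₁) (restrict X⊆F) (flat-trans flat₁ f₁))
          (subst (FlatIn E₂) (restrict X⊆F) (flat-trans flat₂ f₂))) X⊆F F⊆E
      }

-- Contraction

-- S is a simplification of the contraction of A by its flat K.
record Transversal (𝒞 : Closure m) (A K S : Subset m) : Set where
  open Closure 𝒞
  field
    S⊆A         : S ⊆ A
    nonloop     : ∀ {s} → s ∈ S → s ∉ K
    no-parallel : ∀ {s t} → s ∈ S → t ∈ S → Cl (⁅ t ⁆ ∪ K) s → s ≡ t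
    represent   : ∀ {a} → a ∈ A → a ∉ K → ∃ λ s → s ∈ S × Cl (⁅ s ⁆ ∪ K) a

module Contraction {𝒞 : Closure m} {A K S : Subset m}
  (flatK : Closure.FlatIn 𝒞 A K) (tr : Transversal 𝒞 A K S) where
  open Closure 𝒞
  open Transversal tr
  module 𝒦 = Closure (𝒞 / K)

  K⊆A : K ⊆ A
  K⊆A = proj₁ flatK

  parallel-sym : ∀ {a b} → a ∈ A → a ∉ K → Cl (⁅ b ⁆ ∪ K) a → Cl (⁅ a ⁆ ∪ K) b
  parallel-sym a∈A a∉K c =
    cl-mono (∪-lub ∪ʳ ∪ˡ) (exchange (cl-mono (∪-lub ∪ʳ ∪ˡ) c) (a∉K ∘ proj₂ flatK a∈A))

  cl-via : ∀ {X a b} → Cl (⁅ b ⁆ ∪ K) a → Cl (X ∪ K) b → Cl (X ∪ K) a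
  cl-via c cb = cl-cut∪ (cl-⁅⁆ cb) (cl-ext ∘ ∪ʳ) c

  -- The elements of S representing E.
  image : Subset m → Subset m
  image E = clIn S (E ∪ K)

  image⊆S : ∀ {E} → image E ⊆ S
  image⊆S = clIn-⊆

  image-∈ : ∀ {E e s} → e ∈ E → s ∈ S → Cl (⁅ e ⁆ ∪ K) s → s ∈ image E
  image-∈ e∈E s∈S c = clIn⁺ s∈S (cl-via c (cl-ext (∪ˡ e∈E)))

  image-mono : ∀ {D E} → D ⊆ E → image D ⊆ image E
  image-mono D⊆E p = clIn⁺ (image⊆S p) (cl-mono (∪-lub (∪ˡ ∘ D⊆E) ∪ʳ) (clIn⁻ p))

  image⁻ : ∀ {E s} → ModularIn A E → s ∈ image E →
    ∃ λ e → e ∈ E × e ∉ K × Cl (⁅ s ⁆ ∪ K) e × Cl (⁅ e ⁆ ∪ K) s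
  image⁻ modE p =
    let s∈S = image⊆S p
        e , e∈E , e∉K , c = pull-back modE flatK (S⊆A s∈S) (clIn⁻ p) (nonloop s∈S)
    in e , e∈E , e∉K , c , parallel-sym (proj₁ (proj₁ modE) e∈E) e∉K c

  image⁺ : ∀ {E e} → E ⊆ A → e ∈ E → e ∉ K →
    ∃ λ s → s ∈ image E × Cl (⁅ s ⁆ ∪ K) e × Cl (⁅ e ⁆ ∪ K) s
  image⁺ E⊆A e∈E e∉K =
    let s , s∈S , c = represent (E⊆A e∈E) e∉K
        c′ = parallel-sym (E⊆A e∈E) e∉K c
    in s , image-∈ e∈E s∈S c′ , c , c′

  image-simple : ∀ {E} → Simple (𝒞 / K) (image E)
  image-simple =
    (λ s∈ c → nonloop (image⊆S s∈) (proj₂ flatK (S⊆A (image⊆S s∈)) (cl-mono (∪-lub (⊥-elim ∘ ∉⊥) id) c))) ,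
    (λ s∈ t∈ → no-parallel (image⊆S s∈) (image⊆S t∈))

  -- Translate back to `A`: a flat `P` becomes the flat `P′` of `A` spanned by `P ∪ K`, and `X`
  -- becomes `X′`, the part of `T` spanned by `X ∪ K`. An element of `T ∩ P′` outside `K` has a
  -- representative in `image T`, which lies in `P` and hence in `X`; so `T ∩ P′ ⊆ X′` and
  -- modularity of `T` in `A` applies.
  image-modular : ∀ {E T} → ModularIn A T → T ⊆ E → 𝒦.ModularIn (image E) (image T)
  image-modular {E} {T} modT@((T⊆A , _) , mod) T⊆E =
    (image-mono T⊆E , λ s∈ c → clIn⁺ (image⊆S s∈) (cl-cut∪ clIn⁻ (cl-ext ∘ ∪ʳ) c)) , mod′
    where
    mod′ : ∀ P → 𝒦.FlatIn (image E) P → ∀ X → X ⊆ image T → image T ∩ P ⊆ X →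
      ∀ {s} → s ∈ image T → Cl ((X ∪ P) ∪ K) s → Cl (X ∪ K) s
    mod′ P (P⊆ , flatP) X X⊆ ⊆X {s} s∈ c =
      let t , t∈T , t∉K , c₁ , c₂ = image⁻ modT s∈ in
      cl-via c₂ (cl-cut clIn⁻ (mod P′ (clIn-flat A _) X′ clIn-⊆ T∩P′⊆X′ t∈T
        (cl-cut (cl-cut∪-K c) c₁)))
      where
      P′ X′ : Subset m
      P′ = clIn A (P ∪ K)
      X′ = clIn T (X ∪ K)
      T∩P′⊆X′ : T ∩ P′ ⊆ X′
      T∩P′⊆X′ {t} p with t ∈? K
      ... | yes t∈K = clIn⁺ (∩ˡ p) (cl-ext (∪ʳ t∈K))
      ... | no t∉K =
        let s , s∈ , c₁ , c₂ = image⁺ T⊆A (∩ˡ p) t∉K in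
        clIn⁺ (∩ˡ p) (cl-via c₁ (cl-ext (∪ˡ (⊆X (∩⁺ s∈
          (flatP (image-mono T⊆E s∈) (cl-via c₂ (clIn⁻ (∩ʳ p)))))))))
      K⊆ : ∀ {x} → x ∈ K → Cl (X′ ∪ P′) x
      K⊆ x∈K = cl-ext (∪ʳ (clIn⁺ (K⊆A x∈K) (cl-ext (∪ʳ x∈K))))
      member : ∀ {x} → x ∈ X ∪ P → Cl (X′ ∪ P′) x
      member x∈ with ∪-case x∈
      ... | inj₂ x∈P = cl-ext (∪ʳ (clIn⁺ (S⊆A (image⊆S (P⊆ x∈P))) (cl-ext (∪ˡ x∈P))))
      ... | inj₁ x∈X =
        let t , t∈T , t∉K , c₁ , c₂ = image⁻ modT (X⊆ x∈X) in
        cl-cut∪ (cl-⁅⁆ (cl-ext (∪ˡ (clIn⁺ t∈T (cl-via c₁ (cl-ext (∪ˡ x∈X))))))) K⊆ c₂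
      cl-cut∪-K : Cl ((X ∪ P) ∪ K) s → ∀ {x} → x ∈ ⁅ s ⁆ ∪ K → Cl (X′ ∪ P′) x
      cl-cut∪-K c x∈ = [ cl-⁅⁆ (cl-cut∪ member K⊆ c) , K⊆ ]′ (∪-case x∈)

  -- Contraction of a gluing

  module _ {E E₁ E₂ : Subset m} (G : Glue 𝒞 E E₁ E₂)
    (modE : ModularIn A E) (mod₁ : ModularIn A E₁) (mod₂ : ModularIn A E₂) where
    open Glue G

    private
      E₁⊆A : E₁ ⊆ A
      E₁⊆A = proj₁ (proj₁ mod₁)
      E₂⊆A : E₂ ⊆ A
      E₂⊆A = proj₁ (proj₁ mod₂)
      E⊆A : E ⊆ A
      E⊆A = proj₁ (proj₁ modE)

    image-split : ∀ {s} → s ∈ image E → s ∈ image E₁ ⊎ s ∈ image E₂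
    image-split s∈ =
      let e , e∈E , _ , _ , c = image⁻ modE s∈ in
      [ (λ e∈ → inj₁ (image-∈ e∈ (image⊆S s∈) c)) , (λ e∈ → inj₂ (image-∈ e∈ (image⊆S s∈) c)) ]′ (split e∈E)

    -- If s is parallel to e₁ ∈ E₁ and e₂ ∈ E₂ but to no element of E₁ ∩ E₂, then the flat of E₁
    -- spanned by K ∩ E₁ and e₁ together with K ∩ E₂ is a flat of E that avoids e₂ but spans it modulo
    -- K, against the modularity of E.
    image-∩ : image E₁ ∩ image E₂ ≡ image (E₁ ∩ E₂)
    image-∩ = ⊆-antisym ⊆-dir λ p → ∩⁺ (image-mono ∩ˡ p) (image-mono ∩ʳ p)
      where
      ⊆-dir : image E₁ ∩ image E₂ ⊆ image (E₁ ∩ E₂)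
      ⊆-dir {s} p with image⁻ mod₁ (∩ˡ p) | image⁻ mod₂ (∩ʳ p)
      ... | e₁ , e₁∈ , e₁∉K , s⇒e₁ , e₁⇒s | e₂ , e₂∈ , e₂∉K , s⇒e₂ , _ =
        clIn⁺ (image⊆S (∩ˡ p)) (decidable-stable (cl? _ s) absurd)
        where
        B₁ B : Subset m
        B₁ = clIn E₁ ((K ∩ E₁) ∪ ⁅ e₁ ⁆)
        B = B₁ ∪ (K ∩ E₂)
        absurd : ¬ ¬ Cl ((E₁ ∩ E₂) ∪ K) s
        absurd ¬c = e₂∉K (∩ˡ (subst (e₂ ∈_) B∩E₂ (∩⁺ e₂∈B e₂∈)))
          where
          B₁∩E₂⊆K : ∀ {x} → x ∈ B₁ → x ∈ E₂ → x ∈ K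
          B₁∩E₂⊆K {x} x∈B₁ x∈E₂ with x ∈? K
          ... | yes x∈K = x∈K
          ... | no x∉K = ⊥-elim (¬c (cl-via e₁⇒s (cl-via
              (parallel-sym (E₂⊆A x∈E₂) x∉K (cl-mono (∪-lub (∪ʳ ∘ ∩ˡ) ∪ˡ) (clIn⁻ x∈B₁)))
              (cl-ext (∪ˡ (∩⁺ (clIn-⊆ x∈B₁) x∈E₂))))))
          B∩E₁ : B ∩ E₁ ≡ B₁
          B∩E₁ = ⊆-antisym
            (λ p → [ id , (λ x∈ → clIn⁺ (∩ʳ p) (cl-ext (∪ˡ (∩⁺ (∩ˡ x∈) (∩ʳ p))))) ]′ (∪-case (∩ˡ p)))
            (λ x∈ → ∩⁺ (∪ˡ x∈) (clIn-⊆ x∈))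
          B∩E₂ : B ∩ E₂ ≡ K ∩ E₂
          B∩E₂ = ⊆-antisym
            (λ p → [ (λ x∈ → ∩⁺ (B₁∩E₂⊆K x∈ (∩ʳ p)) (∩ʳ p)) , id ]′ (∪-case (∩ˡ p)))
            (λ x∈ → ∩⁺ (∪ʳ x∈) (∩ʳ x∈))
          B⊆E : B ⊆ E
          B⊆E = ∪-lub (E₁⊆E ∘ clIn-⊆) (E₂⊆E ∘ ∩ʳ)
          e₂∈B : e₂ ∈ B
          e₂∈B = proj₂ (flat B⊆E
              (subst (FlatIn E₁) (sym B∩E₁) (clIn-flat E₁ _))
              (subst (FlatIn E₂) (sym B∩E₂) (flat-∩ flatK E₂⊆A)))
            (E₂⊆E e₂∈)
            (proj₂ modE K flatK B B⊆E
              (λ p → [ (λ x∈ → ∪ˡ (clIn⁺ x∈ (cl-ext (∪ˡ (∩⁺ (∩ʳ p) x∈))))) , (λ x∈ → ∪ʳ (∩⁺ (∩ʳ p) x∈)) ]′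
                (split (∩ˡ p)))
              (E₂⊆E e₂∈)
              (cl-via s⇒e₂ (cl-via e₁⇒s (cl-ext (∪ˡ (∪ˡ (clIn⁺ e₁∈ (cl-ext (∪ʳ (x∈⁅x⁆ e₁))))))))))

    -- The two traces of `X` are lifted, together with `K`, to flats `U₁` and `U₂` of the parts.
    -- They agree on the overlap, so their union `U` is a flat of `E`. An element of `image E`
    -- spanned by `X ∪ K` is parallel modulo `K` to some `e` of `E`; modularity of `E` against `K`
    -- removes `K`, leaving `e` in `U`, and returning to `S` lands in `X`.
    image-glue : Glue (𝒞 / K) (image E) (image E₁) (image E₂)
    image-glue = record
      { E≡E₁∪E₂ = ⊆-antisym
          (λ s∈ → [ ∪ˡ , ∪ʳ ]′ (image-split s∈))
          (∪-lub (image-mono E₁⊆E) (image-mono E₂⊆E))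
      ; flat = image-flat
      }
      where
      module _ {X : Subset m} (X⊆ : X ⊆ image E)
        (f₁ : 𝒦.FlatIn (image E₁) (X ∩ image E₁)) (f₂ : 𝒦.FlatIn (image E₂) (X ∩ image E₂)) where

        U₁ U₂ U : Subset m
        U₁ = clIn E₁ ((X ∩ image E₁) ∪ K)
        U₂ = clIn E₂ ((X ∩ image E₂) ∪ K)
        U = U₁ ∪ U₂

        cross : ∀ {D₁ D₂} → D₁ ⊆ A → 𝒦.FlatIn (image D₂) (X ∩ image D₂) → ∀ {y} →
          y ∈ clIn D₂ ((X ∩ image D₂) ∪ K) → y ∈ D₁ → y ∈ clIn D₁ ((X ∩ image D₁) ∪ K)
        cross D₁⊆A f {y} y∈ y∈D₁ with y ∈? K
        ... | yes y∈K = clIn⁺ y∈D₁ (cl-ext (∪ʳ y∈K))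
        ... | no y∉K =
          -- The representative of `y` belongs to both images, as `y` lies in both parts. Flatness
          -- of the trace of `X` on the one side puts it in `X`, so it also counts on the other.
          let s , s∈ , c₁ , c₂ = image⁺ D₁⊆A y∈D₁ y∉K
              s∈X = ∩ˡ (proj₂ f (image-∈ (clIn-⊆ y∈) (image⊆S s∈) c₂) (cl-via c₂ (clIn⁻ y∈)))
          in clIn⁺ y∈D₁ (cl-via c₁ (cl-ext (∪ˡ (∩⁺ s∈X s∈))))

        U∩E₁ : U ∩ E₁ ≡ U₁
        U∩E₁ = ⊆-antisym (λ p → [ id , (λ y∈ → cross E₁⊆A f₂ y∈ (∩ʳ p)) ]′ (∪-case (∩ˡ p)))
          (λ y∈ → ∩⁺ (∪ˡ y∈) (clIn-⊆ y∈))
        U∩E₂ : U ∩ E₂ ≡ U₂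
        U∩E₂ = ⊆-antisym (λ p → [ (λ y∈ → cross E₂⊆A f₁ y∈ (∩ʳ p)) , id ]′ (∪-case (∩ˡ p)))
          (λ y∈ → ∩⁺ (∪ʳ y∈) (clIn-⊆ y∈))
        U⊆E : U ⊆ E
        U⊆E = ∪-lub (E₁⊆E ∘ clIn-⊆) (E₂⊆E ∘ clIn-⊆)
        flatU : FlatIn E U
        flatU = flat U⊆E (subst (FlatIn E₁) (sym U∩E₁) (clIn-flat E₁ _))
                         (subst (FlatIn E₂) (sym U∩E₂) (clIn-flat E₂ _))
        E∩K⊆U : E ∩ K ⊆ U
        E∩K⊆U p = [ (λ e∈ → ∪ˡ (clIn⁺ e∈ (cl-ext (∪ʳ (∩ʳ p))))) ,
                    (λ e∈ → ∪ʳ (clIn⁺ e∈ (cl-ext (∪ʳ (∩ʳ p))))) ]′ (split (∩ˡ p))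

        spanned : ∀ {D} → ModularIn A D → clIn D ((X ∩ image D) ∪ K) ⊆ U →
          ∀ {x} → x ∈ X → x ∈ image D → Cl (U ∪ K) x
        spanned modD ⊆U x∈X x∈ =
          let e , e∈D , _ , c₁ , c₂ = image⁻ modD x∈ in
          cl-via c₂ (cl-ext (∪ˡ (⊆U (clIn⁺ e∈D (cl-via c₁ (cl-ext (∪ˡ (∩⁺ x∈X x∈))))))))

        X⊆clU : ∀ {x} → x ∈ X → Cl (U ∪ K) x
        X⊆clU x∈X = [ spanned mod₁ ∪ˡ x∈X , spanned mod₂ ∪ʳ x∈X ]′ (image-split (X⊆ x∈X))

        image-flat : 𝒦.FlatIn (image E) X
        image-flat = X⊆ , λ s∈ c →
          let e , e∈E , _ , s⇒e , e⇒s = image⁻ modE s∈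
              s∈S = image⊆S s∈
              e∈U = proj₂ flatU e∈E (proj₂ modE K flatK U U⊆E E∩K⊆U e∈E
                      (cl-via s⇒e (cl-cut∪ X⊆clU (cl-ext ∘ ∪ʳ) c)))
          in [ (λ e∈ → ∩ˡ (proj₂ f₁ (image-∈ (clIn-⊆ e∈) s∈S e⇒s) (cl-via e⇒s (clIn⁻ e∈)))) ,
               (λ e∈ → ∩ˡ (proj₂ f₂ (image-∈ (clIn-⊆ e∈) s∈S e⇒s) (cl-via e⇒s (clIn⁻ e∈)))) ]′ (∪-case e∈U)

  module _ {ρ ρ′ : Subset m → ℕ} (rk : RankOf 𝒞 ρ) (rk′ : RankOf (𝒞 / K) ρ′) where

    -- Although `K` need not lie in `E`, modularity says that inside `E` contracting `K` has the
    -- same effect as contracting `K ∩ E`. That contraction is again a represented geometry, and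
    -- choosing representatives in `S` removes its loops and parallel elements.
    image-PG : ∀ {E} → ModularIn A E → IsPGq q (mat m E ρ) → IsPGq q (mat m (image E) ρ′)
    image-PG {E = E} modE@((E⊆A , _) , mod) (F , k , P) = rep⇒isPG rk′ image-simple
      (rep-transfer {𝒞 = 𝒞 / K}
        (λ s∈ → let e , e∈E , _ , c₁ , c₂ = image⁻ modE s∈ in e , e∈E , c₂ , c₁)
        (λ e∈E ¬loop → let s , s∈ , c₁ , c₂ = image⁺ E⊆A e∈E (λ e∈K → ¬loop (cl-ext (∪ʳ e∈K)))
          in s , s∈ , c₂ , c₁)
        (rep-cong {𝒞 = 𝒞 / (K ∩ E)} {𝒞 / K}
          (λ _ _ → cl-mono (∪-lub ∪ˡ (∪ʳ ∘ ∩ˡ)))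
          (λ X⊆E e∈E c → mod K flatK _ (∪-lub X⊆E ∩ʳ) (λ p → ∪ʳ (∩⁺ (∩ʳ p) (∩ˡ p))) e∈E
            (cl-mono (∪-lub (∪ˡ ∘ ∪ˡ) ∪ʳ) c))
          (rep-contract (isPG⇒rep rk P) (K ∩ E) ∩ʳ)))
      where open Representation F

    -- `modular-trans` keeps the hypothesis alive relative to the fixed `A` as `E` is replaced by
    -- its parts and by their intersection.
    image-chordal : ∀ {E} → ModularIn A E → Chordal q (mat m E ρ) → Chordal q (mat m (image E) ρ′)
    image-chordal modE (pg _ _ P) = pg _ (RankOf.isMatroid rk′ _) (image-PG modE P)
    image-chordal {q = q} {E = E} modE (gpc _ E₁ E₂ _ E≡ c₁ c₂ mod P flats) =
      glue⇒chordal rk′ (image-glue G modE mod₁ mod₂) (image-chordal mod₁ c₁) (image-chordal mod₂ c₂)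
        (subst (𝒦.ModularIn (image E₁)) (sym T≡) (image-modular modT ∩ˡ))
        (subst (λ T → IsPGq q (mat m T ρ′)) (sym T≡) (image-PG modT P))
      where
      G : Glue 𝒞 E E₁ E₂
      G = flats⇒glue rk E≡ flats
      mod₁ : ModularIn A E₁
      mod₁ = modular-trans modE (proj₁ (parts-modular rk G c₂ mod P))
      mod₂ : ModularIn A E₂
      mod₂ = modular-trans modE (proj₂ (parts-modular rk G c₂ mod P))
      modT : ModularIn A (E₁ ∩ E₂)
      modT = modular-trans mod₁ (RankOf.ModularFlat⇒ModularIn rk mod)
      T≡ : image E₁ ∩ image E₂ ≡ image (E₁ ∩ E₂)
      T≡ = image-∩ G modE mod₁ mod₂

-- A matroid extends to a rank function on all subsets of the universe, the elements outside
-- the ground set becoming loops.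

module _ {A : Subset m} {r : Subset m → ℕ} (M : IsMatroid (mat m A r)) where
  open Nat using (_+_)
  open IsMatroid M

  extend : Subset m → ℕ
  extend X = r (X ∩ A)

  extend-agree : Agree A r extend
  extend-agree X⊆A = cong r (sym (X⊆Y⇒X∩Y≡X X⊆A))

  extend-isRank : IsRank extend
  extend-isRank = record
    { bound = λ X → ℕₚ.≤-trans (r-bound (X ∩ A) ∩ʳ) (∣p∩q∣≤∣p∣ X A)
    ; mono = λ X⊆Y → r-mono _ _ (λ p → ∩⁺ (X⊆Y (∩ˡ p)) (∩ʳ p)) ∩ʳ
    ; submod = λ X Y → subst (_≤ extend X + extend Y)
        (cong₂ _+_ (cong r (sym (∩-distribʳ-∪ A X Y))) (cong r (sym (∩-distribʳ-∩ X Y))))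
        (r-submod (X ∩ A) (Y ∩ A) ∩ʳ ∩ʳ)
    }
    where
    ∩-distribʳ-∩ : ∀ X Y → (X ∩ Y) ∩ A ≡ (X ∩ A) ∩ (Y ∩ A)
    ∩-distribʳ-∩ X Y = ⊆-antisym
      (λ p → ∩⁺ (∩⁺ (∩ˡ (∩ˡ p)) (∩ʳ p)) (∩⁺ (∩ʳ (∩ˡ p)) (∩ʳ p)))
      (λ p → ∩⁺ (∩⁺ (∩ˡ (∩ˡ p)) (∩ˡ (∩ʳ p))) (∩ʳ (∩ˡ p)))

-- Return to the given rank functions

chordal-restrict : ∀ {M F} → Chordal q M → Flat M F → Chordal q (Restrict M F)
chordal-restrict {M = mat m A r} {F} c flatF =
  chordal-resp (λ X⊆F → sym (agree (proj₁ flatF ∘ X⊆F)))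
    (chordal-flat rk (RankOf.Flat⇒FlatIn rk (flat-resp agree flatF)) (chordal-resp agree c))
  where
  isM : IsMatroid (mat m A r)
  isM = chordal⇒isMatroid c
  agree : Agree A r (extend isM)
  agree = extend-agree isM
  rk : RankOf (IsRank.closure (extend-isRank isM)) (extend isM)
  rk = rankOf (extend-isRank isM)

chordal-contract : ∀ {M C S} → Chordal q M → C ⊆ E M → IsSimplification (Contract M C) S →
  Chordal q (Restrict (Contract M C) S)
chordal-contract {M = mat m A r} {C} {S} c C⊆A (S⊆ , rank-1 , rank-2 , represents) =
  chordal-resp agree-S (subst (λ T → Chordal _ (mat m T ρC)) image-A
    (image-chordal rk (contraction-rank rk (λ x∈C → clIn⁺ (C⊆A x∈C) (cl-ext x∈C)) clIn⁻)
      -- The induction starts at `E = A`, which is modular in itself because every flat is contained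
      -- in it.
      ((id , λ e∈A _ → e∈A) , λ P flatP X X⊆A A∩P⊆X t∈A → cl-mono (∪-lub id λ p → A∩P⊆X (∩⁺ (proj₁ flatP p) p)))
      (chordal-resp agree c)))
  where
  isM : IsMatroid (mat m A r)
  isM = chordal⇒isMatroid c
  ρ : Subset m → ℕ
  ρ = extend isM
  agree : Agree A r ρ
  agree = extend-agree isM
  rk : RankOf (IsRank.closure (extend-isRank isM)) ρ
  rk = rankOf (extend-isRank isM)
  open RankOf rk
  open Closure (IsRank.closure (extend-isRank isM))
  ρC : Subset m → ℕ
  ρC X = ρ (X ∪ C) ∸ ρ C
  K : Subset m
  K = clIn A C
  S⊆A : S ⊆ A
  S⊆A s∈ = p─q⊆p A C (S⊆ s∈)
  contract-agree : Agree A ρC (λ X → r (X ∪ C) ∸ r C)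
  contract-agree X⊆A = cong₂ _∸_ (sym (agree (∪-lub X⊆A C⊆A))) (sym (agree C⊆A))
  agree-S : Agree S ρC (λ X → r (X ∪ C) ∸ r C)
  agree-S X⊆S = contract-agree (S⊆A ∘ X⊆S)
  -- The truncated subtraction can be undone since `ρ C` is at most `ρ (X ∪ C)`.
  rank-of : ∀ {X j} → X ⊆ A → r (X ∪ C) ∸ r C ≡ j → ρ (X ∪ C) ≡ j Nat.+ ρ C
  rank-of X⊆A eq = trans (sym (ℕₚ.m∸n+n≡m (mono ∪ʳ))) (cong (Nat._+ ρ C) (trans (contract-agree X⊆A) eq))
  S∉K : ∀ {s} → s ∈ S → s ∉ K
  S∉K {s} s∈S s∈K = ℕₚ.1+n≢n (trans (sym (rank-of (⁅⁆⊆ (S⊆A s∈S)) (rank-1 s s∈S)))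
    (trans (cong ρ (∪-comm ⁅ s ⁆ C)) (cl⇒ (clIn⁻ s∈K))))
  drop-K : ∀ {X x} → Cl (X ∪ K) x → Cl (X ∪ C) x
  drop-K = cl-cut∪ (cl-ext ∘ ∪ˡ) (cl-mono ∪ʳ ∘ clIn⁻)
  add-C : ∀ s t → (⁅ t ⁆ ∪ C) ∪ ⁅ s ⁆ ≡ (⁅ s ⁆ ∪ ⁅ t ⁆) ∪ C
  add-C s t = ⊆-antisym (∪-lub (∪-lub (∪ˡ ∘ ∪ʳ) ∪ʳ) (∪ˡ ∘ ∪ˡ)) (∪-lub (∪-lub ∪ʳ (∪ˡ ∘ ∪ˡ)) (∪ˡ ∘ ∪ʳ))
  tr : Transversal (IsRank.closure (extend-isRank isM)) A K S
  tr = record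
    { S⊆A = S⊆A
    ; nonloop = S∉K
    ; no-parallel = λ {s} {t} s∈S t∈S c → decidable-stable (s ≟ t) λ s≢t →
        ℕₚ.1+n≢n (trans
          (sym (rank-of (∪-lub (⁅⁆⊆ (S⊆A s∈S)) (⁅⁆⊆ (S⊆A t∈S))) (rank-2 s t s∈S t∈S s≢t)))
          (trans (cong ρ (sym (add-C s t)))
            (trans (cl⇒ (drop-K c)) (rank-of (⁅⁆⊆ (S⊆A t∈S)) (rank-1 t t∈S)))))
    ; represent = λ {a} a∈A a∉K →
        let a∉C = λ a∈C → a∉K (clIn⁺ a∈A (cl-ext a∈C))
            rank-a = trans (sym (contract-agree (⁅⁆⊆ a∈A))) (trans (cong (_∸ ρ C)
              (trans (cong ρ (∪-comm ⁅ a ⁆ C)) (¬cl⇒ (a∉K ∘ clIn⁺ a∈A)))) (ℕₚ.m+n∸n≡m 1 (ρ C)))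
            s , s∈S , eq = represents a (x∈p∧x∉q⇒x∈p─q a∈A a∉C) rank-a
        in s , s∈S , cl-mono (∪-lub ∪ˡ λ x∈C → ∪ʳ (clIn⁺ (C⊆A x∈C) (cl-ext x∈C)))
          (⇒cl (trans (cong ρ (add-C a s))
            (trans (rank-of (∪-lub (⁅⁆⊆ a∈A) (⁅⁆⊆ (S⊆A s∈S))) eq)
              (sym (rank-of (⁅⁆⊆ (S⊆A s∈S)) (rank-1 s s∈S))))))
    }
  open Contraction (clIn-flat A C) tr
  image-A : image A ≡ S
  image-A = ⊆-antisym image⊆S (λ s∈S → image-∈ (S⊆A s∈S) s∈S (cl-ext (∪ˡ (x∈⁅x⁆ _))))

theorem1p2 : ∀ (q : ℕ) → IsPrimePower q → ∀ (M N : Matroid) →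
    Chordal q M → InducedMinor N M → Chordal q N
theorem1p2 q _ M .M c (here .M) = c
theorem1p2 q pp M N c (restr F flatF minor) = theorem1p2 q pp _ N (chordal-restrict c flatF) minor
theorem1p2 q pp M N c (contr C S C⊆E simplification minor) =
  theorem1p2 q pp _ N (chordal-contract c C⊆E simplification) minor
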